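{- Let $\mu=(\mu_i;i\in I)$ be a signature, i.e. a function $\mu:I\to\mathbb{N}^*$ from an arbitrary index set $I$ into the positive integers. The following statements are equivalent: (i) every ideal of $\Omega_\mu$ is representable; (ii) the set $\mu^{ -1}[\mathbb{N}^*\setminus\{1\}]=\{i\in I:\mu_i\geq 2\}$ is finite; (iii) the set $\mathscr{J}(\Omega_\mu)$ of ideals of $\Omega_\mu$, equipped with the topology induced by the product topology on the power set $\mathfrak{P}(\Omega_\mu)\cong\{0,1\}^{\Omega_\mu}$, is compact.
   Context: A relational structure of signature $\mu$ is $\mathfrak A=(A;(R_i)_{i\in I})$ where each $R_i:A^{\mu_i}\to\{0,1\}$ is a $\mu_i$-ary relation on the set $A$. An embedding of $\mathfrak A$ into $\mathfrak B$ (same signature) is an injective map $f:A\to B$ such that $R^{\mathfrak A}_i(x_1,\dots,x_{\mu_i})=R^{\mathfrak B}_i(f(x_1),\dots,f(x_{\mu_i}))$ for all $i$ and all tuples; $\mathfrak A\le\mathfrak B$ means such an embedding exists. $\Omega_\mu$ is the set of isomorphism types of finite relational structures of signature $\mu$, partially ordered by $\le$. An ideal of $\Omega_\mu$ is a non-empty subset which is an initial segment (downward closed under $\le$) and up-directed. The age of a relational structure $\mathfrak A$ is the set of isomorphism types of its finite induced substructures. An ideal $\mathcal A$ of $\Omega_\mu$ is representable if there is a relational structure $\mathfrak A$ of signature $\mu$ with $\mathrm{age}(\mathfrak A)=\mathcal A$. -}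

module Defs where

open import Level using (Level; _⊔_; suc; 0ℓ)
open import Data.Bool.Base using (Bool; true)
open import Data.Nat.Base using (ℕ)
import Data.Nat.Properties as ℕ
open import Data.Fin.Base using (Fin; punchOut)
open import Data.Fin.Properties using (any?; _≟_; injective⇒≤; punchOut-injective; cantor-schröder-bernstein)
open import Data.List.Base using (List; length; lookup)
open import Data.List.Relation.Unary.All using (All)
open import Data.List.Relation.Unary.Any using (Any)
open import Data.List.Relation.Unary.Unique.Propositional using (Unique)
open import Data.Product.Base using (Σ; Σ-syntax; ∃; ∃-syntax; _×_; _,_; proj₁; proj₂)
open import Data.Vec.Base using (Vec; map)
open import Data.Vec.Properties using (map-id; map-∘; map-cong)
open import Function.Base using (id; _∘_)
open import Function.Bundles using (Func; _⇔_; _↔_)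
open import Function.Definitions using (Injective; Surjective)
open import Relation.Binary.Bundles using (Setoid; Poset)
open import Relation.Binary.PropositionalEquality using (_≡_; refl; sym; trans; cong; setoid)
open import Relation.Nullary using (yes; no; contradiction)
open import Relation.Unary using (Pred; _∈_; _≐_; _⊢_)

private
  variable
    a b c ℓ x y u o : Level

Finite : Set a → Set a
Finite A = ∃[ n ] (A ↔ Fin n)

-- A family of subsets, read as the open sets; the axioms of a topology are not
-- part of the type.
Topology : Set x → (u o : Level) → Set (x ⊔ suc u ⊔ suc o)
Topology X u o = Pred (Pred X u) o

Induced : {X : Set x} {Y : Set y} → (Y → X) → Topology X u o → Topology Y u (x ⊔ y ⊔ suc u ⊔ o)
Induced f τ V = ∃[ U ] (U ∈ τ × V ≐ (f ⊢ U))

-- Separation is not part of the definition: the space it is used for is a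
-- subspace of a Hausdorff space.  Indexing covers by types in the universe of
-- the points loses nothing classically: a subset of X is then determined up to
-- extension by a function X → Bool, and so any cover by some predicate on
-- X → Bool.
Compact : {X : Set x} → Topology X u o → Set (x ⊔ suc x ⊔ suc u ⊔ o)
Compact {x = x} {u = u} {X = X} τ =
  {J : Set x} (U : J → Pred X u) → (∀ j → U j ∈ τ) →
  (∀ p → ∃[ j ] p ∈ U j) →
  Σ[ js ∈ List J ] (∀ p → Any (λ j → p ∈ U j) js)

-- The power set of a setoid, as {0,1}-valued functions respecting its equality.
𝔓 : Setoid c ℓ → Set (c ⊔ ℓ)
𝔓 E = Func E (setoid Bool)

infix 4 _∈ₚ_

_∈ₚ_ : {E : Setoid c ℓ} → Setoid.Carrier E → 𝔓 E → Set
e ∈ₚ S = Func.to S e ≡ true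

-- The product topology on {0,1}^E, with {0,1} discrete: the sets of all T
-- agreeing with a given S at finitely many coordinates form a base.
ProductTopology : (E : Setoid c ℓ) → Topology (𝔓 E) u (c ⊔ ℓ ⊔ u)
ProductTopology E U =
  ∀ S → S ∈ U →
  Σ[ es ∈ List (Setoid.Carrier E) ]
    (∀ T → All (λ e → Func.to S e ≡ Func.to T e) es → T ∈ U)

module _ (P : Poset c ℓ x) where
  open Poset P using (_≤_; module Eq) renaming (Carrier to C)

  record IsIdeal (S : 𝔓 Eq.setoid) : Set (c ⊔ x) where
    field
      nonEmpty   : ∃[ p ] p ∈ₚ S
      downClosed : ∀ p q → p ≤ q → q ∈ₚ S → p ∈ₚ S
      upDirected : ∀ p q → p ∈ₚ S → q ∈ₚ S →
                   ∃[ r ] (r ∈ₚ S × p ≤ r × q ≤ r)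

  𝒥 : Set (c ⊔ ℓ ⊔ x)
  𝒥 = Σ[ S ∈ 𝔓 Eq.setoid ] IsIdeal S

  𝒥-topology : Topology 𝒥 (c ⊔ ℓ ⊔ x) (suc (c ⊔ ℓ ⊔ x))
  𝒥-topology = Induced proj₁ (ProductTopology Eq.setoid)

module _ {I : Set ℓ} (μ : I → ℕ) where

  record Structure (a : Level) : Set (ℓ ⊔ suc a) where
    field
      Carrier : Set a
      rel     : ∀ i → Vec Carrier (μ i) → Bool

  -- Every finite structure is isomorphic to one on some Fin n, and restricting
  -- to those keeps the collection of finite structures small.
  record FinStructure : Set ℓ where
    field
      size : ℕ
      rel  : ∀ i → Vec (Fin size) (μ i) → Bool

  record Embedding (𝔄 : Structure a) (𝔅 : Structure b) : Set (ℓ ⊔ a ⊔ b) where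
    private
      module A = Structure 𝔄
      module B = Structure 𝔅
    field
      to        : A.Carrier → B.Carrier
      injective : Injective _≡_ _≡_ to
      preserves : ∀ i xs → A.rel i xs ≡ B.rel i (map to xs)

  Isomorphism : Structure a → Structure b → Set (ℓ ⊔ a ⊔ b)
  Isomorphism 𝔄 𝔅 = Σ[ f ∈ Embedding 𝔄 𝔅 ] Surjective _≡_ _≡_ (Embedding.to f)

module _ {I : Set ℓ} {μ : I → ℕ} where

  ⟦_⟧ : FinStructure μ → Structure μ 0ℓ
  ⟦ σ ⟧ = record { Carrier = Fin (FinStructure.size σ) ; rel = FinStructure.rel σ }

  -- The substructure induced on the set of entries of xs, transported to
  -- Fin (length xs) along lookup; meant for lists without repetition.
  _↾_ : (𝔄 : Structure μ a) → List (Structure.Carrier 𝔄) → FinStructure μ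
  𝔄 ↾ xs = record
    { size = length xs
    ; rel  = λ i v → Structure.rel 𝔄 i (map (lookup xs) v)
    }

  Age : Structure μ a → Pred (FinStructure μ) (ℓ ⊔ a)
  Age 𝔄 σ = ∃[ xs ] (Unique xs × Isomorphism μ ⟦ σ ⟧ ⟦ 𝔄 ↾ xs ⟧)

  idₑ : {𝔄 : Structure μ a} → Embedding μ 𝔄 𝔄
  idₑ {𝔄 = 𝔄} = record
    { to        = id
    ; injective = id
    ; preserves = λ i xs → cong (Structure.rel 𝔄 i) (sym (map-id xs))
    }

  _∘ₑ_ : {𝔄 : Structure μ a} {𝔅 : Structure μ b} {ℭ : Structure μ c} →
         Embedding μ 𝔅 ℭ → Embedding μ 𝔄 𝔅 → Embedding μ 𝔄 ℭ
  _∘ₑ_ {ℭ = ℭ} g f = record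
    { to        = G.to ∘ F.to
    ; injective = F.injective ∘ G.injective
    ; preserves = λ i xs →
        trans (F.preserves i xs)
        (trans (G.preserves i (map F.to xs))
               (cong (Structure.rel ℭ i) (sym (map-∘ G.to F.to xs))))
    }
    where
    module F = Embedding f
    module G = Embedding g

  ≅-refl : {𝔄 : Structure μ a} → Isomorphism μ 𝔄 𝔄
  ≅-refl = idₑ , λ z → z , id

  ≅-trans : {𝔄 : Structure μ a} {𝔅 : Structure μ b} {ℭ : Structure μ c} →
            Isomorphism μ 𝔄 𝔅 → Isomorphism μ 𝔅 ℭ → Isomorphism μ 𝔄 ℭ
  ≅-trans (f , f-surj) (g , g-surj) = (g ∘ₑ f) , λ z →
    let w , gw = g-surj z
        v , fv = f-surj w
    in v , λ eq → gw (fv eq)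

  ≅-sym : {𝔄 : Structure μ a} {𝔅 : Structure μ b} →
          Isomorphism μ 𝔄 𝔅 → Isomorphism μ 𝔅 𝔄
  ≅-sym {𝔄 = 𝔄} {𝔅 = 𝔅} (f , f-surj) = record
    { to        = from
    ; injective = λ {z} {w} eq → trans (sym (to-from z)) (trans (cong F.to eq) (to-from w))
    ; preserves = λ i xs →
        trans (cong (Structure.rel 𝔅 i)
                (sym (trans (sym (map-∘ F.to from xs))
                     (trans (map-cong to-from xs) (map-id xs)))))
              (sym (F.preserves i (map from xs)))
    } , λ z → F.to z , λ eq → F.injective (trans (to-from _) eq)
    where
    module F = Embedding f
    from : Structure.Carrier 𝔅 → Structure.Carrier 𝔄
    from z = proj₁ (f-surj z)
    to-from : ∀ z → F.to (from z) ≡ z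
    to-from z = proj₂ (f-surj z) refl

injective⇒surjective : ∀ {m n} {f : Fin m → Fin n} → m ≡ n →
                       Injective _≡_ _≡_ f → Surjective _≡_ _≡_ f
injective⇒surjective {n = ℕ.suc n} {f} refl inj z with any? (λ w → f w ≟ z)
... | yes (w , fw≡z) = w , λ { refl → fw≡z }
... | no z∉f = contradiction
  (injective⇒≤ {f = λ w → punchOut (z≢f w)}
    (λ eq → inj (punchOut-injective (z≢f _) (z≢f _) eq)))
  ℕ.1+n≰n
  where
  z≢f : ∀ w → z ≡ f w → _
  z≢f w eq = z∉f (w , sym eq)

-- Isomorphism types of finite structures, ordered by embeddability.
Ω : {I : Set ℓ} → (I → ℕ) → Poset ℓ ℓ ℓ
Ω μ = record
  { Carrier        = FinStructure μ
  ; _≈_            = λ σ τ → Isomorphism μ ⟦ σ ⟧ ⟦ τ ⟧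
  ; _≤_            = λ σ τ → Embedding μ ⟦ σ ⟧ ⟦ τ ⟧
  ; isPartialOrder = record
    { isPreorder = record
      { isEquivalence = record { refl = ≅-refl ; sym = ≅-sym ; trans = ≅-trans }
      ; reflexive     = proj₁
      ; trans         = λ f g → g ∘ₑ f
      }
    ; antisym = λ f g → f , injective⇒surjective
        (cantor-schröder-bernstein (Embedding.injective f) (Embedding.injective g))
        (Embedding.injective f)
    }
  }

Representable : {I : Set ℓ} (μ : I → ℕ) → 𝒥 (Ω μ) → Set (suc ℓ)
Representable {ℓ = ℓ} μ (S , _) =
  Σ[ 𝔄 ∈ Structure μ ℓ ] (∀ σ → (σ ∈ Age 𝔄) ⇔ (σ ∈ₚ S))

module Submission where

open import Defs
open import Axiom.ExcludedMiddle using (ExcludedMiddle)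
open import Axiom.Extensionality.Propositional using (Extensionality)
open import Data.Bool.Base using (Bool; true; false)
open import Data.Bool.Properties using (¬-not)
open import Data.Empty using (⊥; ⊥-elim)
open import Data.Fin.Base as Fin using (Fin; zero; suc; toℕ; splitAt; _↑ˡ_; _↑ʳ_)
open import Data.Fin.Patterns using (0F; 1F; 2F)
import Data.Fin.Properties as Fin
open import Data.List.Base as List using (List; []; _∷_; _++_; length; lookup; tabulate; allFin; cartesianProductWith; concatMap; deduplicate)
open import Data.List.Membership.Propositional using (_∈_; _∉_)
open import Data.List.Membership.Propositional.Properties using (∈-allFin; ∈-cartesianProductWith⁺; ∈-concatMap⁺; ∈-deduplicate⁺; ∈-deduplicate⁻; ∈-lookup; ∈-map⁺; ∈-map⁻; ∈-tabulate⁺; ∈-++⁺ˡ; ∈-++⁺ʳ)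
import Data.List.Properties as List
open import Data.List.Relation.Binary.Subset.Propositional using (_⊆_)
open import Data.List.Relation.Unary.All as All using (All; []; _∷_)
import Data.List.Relation.Unary.All.Properties as All
open import Data.List.Relation.Unary.AllPairs using ([]; _∷_)
open import Data.List.Relation.Unary.Any as Any using (Any; here; there; index)
open import Data.List.Relation.Unary.Any.Properties using (lookup-index)
open import Data.List.Relation.Unary.Unique.Propositional using (Unique)
import Data.List.Relation.Unary.Unique.DecPropositional.Properties as Unique
import Data.List.Relation.Unary.Unique.Propositional.Properties as Unique
open import Data.Maybe.Base using (Maybe; just; nothing)
open import Data.Maybe.Properties using (just-injective)
open import Data.Nat.Base as ℕ using (ℕ; zero; suc; _+_; NonZero; _≤_; _<_; z≤n; s≤s)
import Data.Nat.Properties as ℕ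
open import Data.Product.Base using (Σ; Σ-syntax; ∃-syntax; _×_; _,_; proj₁; proj₂)
open import Data.Sum.Base using (_⊎_; inj₁; inj₂; [_,_]′)
open import Data.Sum.Properties using (inj₁-injective; inj₂-injective)
open import Data.Vec.Base as Vec using (Vec; []; _∷_; map; replicate; toList)
import Data.Vec.Properties as Vec
open import Function.Base using (_∘_; id; case_of_; const)
open import Function.Bundles using (Func; Inverse; Equivalence; mk↔ₛ′; _⇔_; mk⇔)
open import Function.Definitions using (Injective)
open import Level using (Level; _⊔_; 0ℓ; Lift; lift)
open import Relation.Binary.Bundles using (Poset)
open import Relation.Binary.Definitions using (tri<; tri≈; tri>)
open import Relation.Binary.PropositionalEquality using (_≡_; _≢_; refl; sym; trans; cong; cong₂; subst; module ≡-Reasoning)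
open import Relation.Binary.PropositionalEquality.WithK renaming (≡-irrelevant to uip)
open import Relation.Nullary using (¬_; Dec; does; yes; no; contradiction)

-- The tool is compactness: a net of maps E → {0,1} has a cluster point.
--
-- If only finitely many relations are at least binary, then the quantifier-free
-- type of finitely many points is determined by finitely many atomic formulas
-- once the isomorphism types of the single points are known.  To represent an
-- ideal, name the points of the disjoint union D of its members.  Each member r
-- evaluates the atomic formulas over D, through embeddings into r of the members
-- below r; a cluster point of these valuations, modulo the equality it defines,
-- is the required structure.  Likewise, a cluster point of ideals is up-directed,
-- because p and q have, up to isomorphism, only finitely many amalgams generated
-- by their images; so the space of ideals is closed in a compact one.
--
-- If there are infinitely many at least binary relations R₀, R₁, …, then two
-- distinct one-point structures have infinitely many incomparable amalgams on two
-- points, one for each Rₙ₊₁, and the ideals these generate have no cluster point.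
-- Moreover the Rₙ can serve as edge colours, Rₙ(x,y,…,y) saying that the edge from
-- x to y has colour n.  Finite structures properly coloured in this way form an
-- ideal, containing continuum many one-point structures; but in a structure with
-- that age the colours of the edges out of a point would embed the continuum in ℕ.

private
  variable
    a b c ℓ : Level

-- Finite enumerations and tuples.

Enumeration : Set a → Set a
Enumeration A = ∃[ xs ] ((x : A) → x ∈ xs)

enumerate : {A : Set a} → Finite A → Enumeration A
enumerate (n , A↔Fin) = List.map from (allFin n) , λ x →
  subst (_∈ List.map from (allFin n)) (strictlyInverseʳ x) (∈-map⁺ from (∈-allFin (to x)))
  where open Inverse A↔Fin

unique-lookup-injective : {A : Set a} {xs : List A} → Unique xs → Injective _≡_ _≡_ (lookup xs)
unique-lookup-injective (_ ∷ _)  {zero}  {zero}  _  = refl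
unique-lookup-injective (p ∷ _)  {zero}  {suc j} eq = contradiction eq (All.lookup p (∈-lookup j))
unique-lookup-injective (p ∷ _)  {suc i} {zero}  eq = contradiction (sym eq) (All.lookup p (∈-lookup i))
unique-lookup-injective (_ ∷ ps) {suc i} {suc j} eq = cong suc (unique-lookup-injective ps eq)

unique-enumeration⇒finite : {A : Set a} (xs : List A) → Unique xs → (∀ x → x ∈ xs) → Finite A
unique-enumeration⇒finite xs unique complete =
  length xs , mk↔ₛ′ (index ∘ complete) (lookup xs)
    (λ i → unique-lookup-injective unique (sym (lookup-index (complete (lookup xs i)))))
    (λ x → sym (lookup-index (complete x)))

vectors : {A : Set a} → List A → ∀ n → List (Vec A n)
vectors xs zero    = [] ∷ []
vectors xs (suc n) = cartesianProductWith _∷_ xs (vectors xs n)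

∈-vectors : {A : Set a} {xs : List A} → (∀ x → x ∈ xs) → ∀ {n} (v : Vec A n) → v ∈ vectors xs n
∈-vectors complete []      = here refl
∈-vectors complete (x ∷ v) = ∈-cartesianProductWith⁺ _∷_ (complete x) (∈-vectors complete v)

singleton-vector : {A : Set a} {n : ℕ} → n ≡ 1 → (v : Vec A n) → ∃[ x ] v ≡ replicate n x
singleton-vector refl (x ∷ []) = x , refl

map-injective : {A : Set a} {B : Set b} {f : A → B} → Injective _≡_ _≡_ f →
                ∀ {n} → Injective _≡_ _≡_ (map {n = n} f)
map-injective inj {_} {[]}    {[]}    _  = refl
map-injective inj {_} {x ∷ v} {y ∷ w} eq =
  cong₂ _∷_ (inj (Vec.∷-injectiveˡ eq)) (map-injective inj (Vec.∷-injectiveʳ eq))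

-- Ages in terms of embeddings.

module _ {I : Set ℓ} {μ : I → ℕ} where

  module _ (𝔄 : Structure μ a) where
    private module A = Structure 𝔄

    lookup-embedding : {xs : List A.Carrier} → Unique xs → Embedding μ ⟦ 𝔄 ↾ xs ⟧ 𝔄
    lookup-embedding {xs} unique = record
      { to = lookup xs ; injective = unique-lookup-injective unique ; preserves = λ _ _ → refl }

    restrict : {𝔅 : Structure μ b} (e : Embedding μ 𝔅 𝔄) {xs : List A.Carrier} →
               (∀ x → Embedding.to e x ∈ xs) → Embedding μ 𝔅 ⟦ 𝔄 ↾ xs ⟧
    restrict e {xs} covered = record
      { to        = index ∘ covered
      ; injective = λ {x} {y} eq → injective
          (trans (lookup-index (covered x)) (trans (cong (lookup xs) eq) (sym (lookup-index (covered y)))))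
      ; preserves = λ i v → trans (preserves i v) (cong (A.rel i)
          (trans (Vec.map-cong (lookup-index ∘ covered) v) (Vec.map-∘ (lookup xs) (index ∘ covered) v)))
      }
      where open Embedding e

    -- The values of an embedding, listed in order, do not repeat and are as many as the points of
    -- `σ`, so the corestriction to them is onto by counting.
    age⇔embeds : ∀ σ → (Age 𝔄 σ) ⇔ (Embedding μ ⟦ σ ⟧ 𝔄)
    age⇔embeds σ = mk⇔
      (λ (xs , unique , e , _) → _∘ₑ_ (lookup-embedding unique) e)
      (λ e → let open Embedding e
                 r = restrict e {tabulate to} (λ k → ∈-tabulate⁺ k)
             in tabulate to , Unique.tabulate⁺ injective , r
                , injective⇒surjective (sym (List.length-tabulate to)) (Embedding.injective r))

-- Atomic formulas over a set of names.

data Atom {I : Set ℓ} (μ : I → ℕ) (X : Set a) : Set (ℓ ⊔ a) where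
  eqₐ  : X → X → Atom μ X
  relₐ : ∀ i → Vec X (μ i) → Atom μ X

module _ {I : Set ℓ} {μ : I → ℕ} where

  mapAtom : {X : Set a} {Y : Set b} → (X → Y) → Atom μ X → Atom μ Y
  mapAtom f (eqₐ x y)  = eqₐ (f x) (f y)
  mapAtom f (relₐ i v) = relₐ i (map f v)

module _ {I : Set ℓ} {μ : I → ℕ} (nonUnary : Enumeration (∃[ i ] 2 ≤ μ i)) where

  -- Unary relations may be infinitely many and are left out to keep the list finite. Their values
  -- come instead from the structures that the named points are taken from.
  atoms : {X : Set a} → List X → List (Atom μ X)
  atoms xs = cartesianProductWith eqₐ xs xs
          ++ concatMap (λ (i , _) → List.map (relₐ i) (vectors xs (μ i))) (proj₁ nonUnary)

  eq∈atoms : {X : Set a} {xs : List X} → (∀ x → x ∈ xs) → ∀ x y → eqₐ x y ∈ atoms xs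
  eq∈atoms complete x y = ∈-++⁺ˡ (∈-cartesianProductWith⁺ eqₐ (complete x) (complete y))

  rel∈atoms : {X : Set a} {xs : List X} → (∀ x → x ∈ xs) → ∀ i → 2 ≤ μ i → ∀ v → relₐ i v ∈ atoms xs
  rel∈atoms {xs = xs} complete i 2≤μi v = ∈-++⁺ʳ (cartesianProductWith eqₐ xs xs)
    (∈-concatMap⁺ _ (Any.map (λ { refl → ∈-map⁺ (relₐ i) (∈-vectors complete v) }) (proj₂ nonUnary (i , 2≤μi))))

-- Arity one, edge tuples and uniform bounds.

≱2⇒≡1 : ∀ {n} → .{{NonZero n}} → ¬ (2 ≤ n) → n ≡ 1
≱2⇒≡1 {suc zero}    _    = refl
≱2⇒≡1 {suc (suc n)} ¬2≤n = contradiction (s≤s (s≤s z≤n)) ¬2≤n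

fixed-≡ : {A : Set a} {f : A → A} {x y : ∃[ z ] f z ≡ z} → proj₁ x ≡ proj₁ y → x ≡ y
fixed-≡ {x = _ , p} {y = _ , q} refl = cong (_ ,_) (uip p q)

pair : {A : Set a} → ∀ {n} → A → A → Vec A n
pair {n = zero}  _ _ = []
pair {n = suc n} x y = x ∷ replicate n y

map-pair : {A : Set a} {B : Set b} (f : A → B) → ∀ {n} x y → map f (pair {n = n} x y) ≡ pair (f x) (f y)
map-pair f {zero}  x y = refl
map-pair f {suc n} x y = cong (f x ∷_) (Vec.map-replicate f y n)

pair-injective : {A : Set a} → ∀ {n} → 2 ≤ n → {x y x′ y′ : A} →
                 pair {n = n} x y ≡ pair x′ y′ → x ≡ x′ × y ≡ y′
pair-injective (s≤s (s≤s _)) refl = refl , refl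

-- The tail of `v` has constant image, hence is itself constant by injectivity of `f`.
unpair : {A : Set a} {B : Set b} {f : A → B} → Injective _≡_ _≡_ f →
         ∀ {n} → 2 ≤ n → (v : Vec A n) → ∀ {x y} → map f v ≡ pair x y →
         ∃[ x′ ] ∃[ y′ ] (v ≡ pair x′ y′ × f x′ ≡ x × f y′ ≡ y)
unpair {f = f} inj (s≤s (s≤s {n = n} _)) (x′ ∷ y′ ∷ v) eq with Vec.∷-injective eq
... | refl , eq′ with Vec.∷-injective eq′
...   | refl , eq″ = x′ , y′ , cong (λ w → x′ ∷ y′ ∷ w)
          (map-injective inj (trans eq″ (sym (Vec.map-replicate f y′ n)))) , refl , refl

dependent-injective : {A : Set a} {B : A → Set b} {x : A} {y z : B x} →
                      _≡_ {A = Σ A B} (x , y) (x , z) → y ≡ z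
dependent-injective refl = refl

uniform-bound : ∀ k (P : Fin k → ℕ → Set) → (∀ x → ∃[ N ] (∀ n → P x n → n < N)) →
                ∃[ N ] (∀ x n → P x n → n < N)
uniform-bound zero    P bounds = 0 , λ ()
uniform-bound (suc k) P bounds =
  let M , ≤M = bounds zero
      N , ≤N = uniform-bound k (P ∘ suc) (bounds ∘ suc)
  in M ℕ.⊔ N , λ { zero    n p → ℕ.<-≤-trans (≤M n p) (ℕ.m≤m⊔n M N)
                 ; (suc x) n p → ℕ.<-≤-trans (≤N x n p) (ℕ.m≤n⊔m M N) }

fin1-unique : (x y : Fin 1) → x ≡ y
fin1-unique zero zero = refl

-- Classical truth values.

module _ (em : ∀ {a} → ExcludedMiddle a) (ext : ∀ {a b} → Extensionality a b) where

  truth : Set a → Bool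
  truth P = does (em {P = P})

  truth⁺ : {P : Set a} → P → truth P ≡ true
  truth⁺ {P = P} p with em {P = P}
  ... | yes _ = refl
  ... | no ¬p = contradiction p ¬p

  truth⁻ : {P : Set a} → truth P ≡ true → P
  truth⁻ {P = P} eq with em {P = P}
  ... | yes p = p

  stable : {P : Set a} → ¬ ¬ P → P
  stable {P = P} ¬¬p with em {P = P}
  ... | yes p = p
  ... | no ¬p = contradiction ¬p ¬¬p

  iff⇒≡ : ∀ {x y : Bool} → (x ≡ true → y ≡ true) → (y ≡ true → x ≡ true) → x ≡ y
  iff⇒≡ {true}  {y}     f g = sym (f refl)
  iff⇒≡ {false} {true}  f g = g refl
  iff⇒≡ {false} {false} f g = refl

  truth-cong : {P : Set a} {Q : Set b} → (P → Q) → (Q → P) → truth P ≡ truth Q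
  truth-cong f g = iff⇒≡ (truth⁺ ∘ f ∘ truth⁻) (truth⁺ ∘ g ∘ truth⁻)

  -- Zermelo's tower of subsets.

  module _ {X : Set a} where

    Sub : Set a
    Sub = X → Bool

    infix 4 _∈ˢ_ _⊑_

    _∈ˢ_ : X → Sub → Set
    x ∈ˢ s = s x ≡ true

    _⊑_ : Sub → Sub → Set a
    s ⊑ t = ∀ x → x ∈ˢ s → x ∈ˢ t

    ⊑-trans : ∀ {s t u} → s ⊑ t → t ⊑ u → s ⊑ u
    ⊑-trans f g x = g x ∘ f x

    ⊑-antisym : ∀ {s t} → s ⊑ t → t ⊑ s → s ≡ t
    ⊑-antisym f g = ext λ x → iff⇒≡ (f x) (g x)

    -- `truth` turns the union of an arbitrary family of subsets into a Boolean function in the same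
    -- universe, which is the impredicativity that the tower relies on.
    ⋃ : (Sub → Bool) → Sub
    ⋃ p x = truth (∃[ s ] (p s ≡ true × x ∈ˢ s))

    ⋃-upper : ∀ p {s} → p s ≡ true → s ⊑ ⋃ p
    ⋃-upper p ps x x∈s = truth⁺ (_ , ps , x∈s)

    ⋃-least : ∀ p {t} → (∀ s → p s ≡ true → s ⊑ t) → ⋃ p ⊑ t
    ⋃-least p h x x∈ with truth⁻ x∈
    ... | s , ps , x∈s = h s ps x x∈s

    module TowerOf (f : Sub → Sub) (inflationary : ∀ s → s ⊑ f s) where

      data Tower : Sub → Set a where
        next : ∀ {s} → Tower s → Tower (f s)
        sup  : ∀ p → (∀ s → p s ≡ true → Tower s) → Tower (⋃ p)

      -- Extreme elements are the crux of Zermelo's argument: every element of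
      -- the tower is extreme, and extreme elements are comparable to all others.
      Extreme : Sub → Set a
      Extreme x = ∀ {y} → Tower y → y ⊑ x → y ≡ x ⊎ f y ⊑ x

      extreme-compare : ∀ {x y} → Extreme x → Tower y → y ⊑ x ⊎ f x ⊑ y
      extreme-compare ex (next ty) with extreme-compare ex ty
      ... | inj₂ fx⊑y = inj₂ (⊑-trans fx⊑y (inflationary _))
      ... | inj₁ y⊑x with ex ty y⊑x
      ...   | inj₁ refl = inj₂ λ _ → id
      ...   | inj₂ fy⊑x = inj₁ fy⊑x
      extreme-compare {x} ex (sup p h) with em {P = ∃[ s ] (p s ≡ true × f x ⊑ s)}
      ... | yes (s , ps , fx⊑s) = inj₂ (⊑-trans fx⊑s (⋃-upper p ps))
      ... | no ¬above = inj₁ (⋃-least p λ s ps → below s ps (extreme-compare ex (h s ps)))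
        where
        below : ∀ s → p s ≡ true → s ⊑ x ⊎ f x ⊑ s → s ⊑ x
        below s ps (inj₁ s⊑x)  = s⊑x
        below s ps (inj₂ fx⊑s) = contradiction (s , ps , fx⊑s) ¬above

      extreme : ∀ {x} → Tower x → Extreme x
      extreme (next tx) ty y⊑fx with extreme-compare (extreme tx) ty
      ... | inj₂ fx⊑y = inj₁ (⊑-antisym y⊑fx fx⊑y)
      ... | inj₁ y⊑x with extreme tx ty y⊑x
      ...   | inj₁ refl = inj₂ λ _ → id
      ...   | inj₂ fy⊑x = inj₂ (⊑-trans fy⊑x (inflationary _))
      extreme (sup p h) {y} ty y⊑ with em {P = ∃[ z ] (p z ≡ true × ¬ (z ⊑ y))}
      ... | no ¬z = inj₁ (⊑-antisym y⊑ (⋃-least p λ s ps → stable λ s⋢y → ¬z (s , ps , s⋢y)))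
      -- Some `z` in the family is not below `y`. Comparability puts `y` below `z`, and as `y` is
      -- not `z`, extremeness of `z` gives `f y ⊑ z`.
      ... | yes (z , pz , z⋢y) with extreme-compare (extreme (h z pz)) ty
      ...   | inj₂ fz⊑y = contradiction (⊑-trans (inflationary z) fz⊑y) z⋢y
      ...   | inj₁ y⊑z with extreme (h z pz) ty y⊑z
      ...     | inj₁ refl = contradiction (λ _ → id) z⋢y
      ...     | inj₂ fy⊑z = inj₂ (⊑-trans fy⊑z (⋃-upper p pz))

      tower-total : ∀ {x y} → Tower x → Tower y → x ⊑ y ⊎ y ⊑ x
      tower-total tx ty with extreme-compare (extreme tx) ty
      ... | inj₁ y⊑x  = inj₂ y⊑x
      ... | inj₂ fx⊑y = inj₁ (⊑-trans (inflationary _) fx⊑y)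

      top : Sub
      top = ⋃ (truth ∘ Tower)

      top-tower : Tower top
      top-tower = sup _ λ _ → truth⁻

      -- The tower contains its own union, hence also `f top`, which therefore lies below that
      -- union.
      top-fixed : f top ⊑ top
      top-fixed = ⋃-upper _ (truth⁺ (next top-tower))

    -- The Teichmüller-Tukey lemma.

    module _ (Good : List X → Set b)
             (antitone : ∀ {xs ys} → xs ⊆ ys → Good ys → Good xs)
             (good[] : Good []) where

      private
        Consistent : Sub → Set _
        Consistent s = ∀ xs → All (_∈ˢ s) xs → Good xs

        Extends : Sub → X → Set _
        Extends s x = ¬ (x ∈ˢ s) × (∀ xs → All (_∈ˢ s) xs → Good (x ∷ xs))

        -- Excluded middle at a Σ-type returns a witness, so it doubles as the choice function of
        -- Zermelo's argument. The decision is an argument so that later proofs can split on it.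
        extend : ∀ s → Dec (∃[ x ] Extends s x) → Sub
        extend s (yes (x , _)) y = truth (y ∈ˢ s ⊎ y ≡ x)
        extend s (no _)          = s

        extend-inflationary : ∀ s d → s ⊑ extend s d
        extend-inflationary s (yes _) y y∈s = truth⁺ (inj₁ y∈s)
        extend-inflationary s (no _)  y y∈s = y∈s

        open TowerOf (λ s → extend s em) (λ s → extend-inflationary s em)

        separate : ∀ {P : X → Set} {x} xs → All (λ y → P y ⊎ y ≡ x) xs →
                   ∃[ ys ] (All P ys × xs ⊆ x ∷ ys)
        separate []       []              = [] , [] , λ ()
        separate (y ∷ xs) (py ∷ pxs) with separate xs pxs
        separate (y ∷ xs) (inj₁ py ∷ _)   | ys , pys , inc = y ∷ ys , py ∷ pys , λ
          { (here refl) → there (here refl)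
          ; (there z∈)  → case inc z∈ of λ { (here eq) → here eq ; (there z∈ys) → there (there z∈ys) } }
        separate (y ∷ xs) (inj₂ refl ∷ _) | ys , pys , inc = ys , pys , λ
          { (here refl) → here refl
          ; (there z∈)  → inc z∈ }

        extend-consistent : ∀ s d → Consistent s → Consistent (extend s d)
        extend-consistent s (no _) con = con
        extend-consistent s (yes (x , _ , ok)) con xs pxs
          with separate xs (All.map truth⁻ pxs)
        ... | ys , pys , inc = antitone inc (ok ys pys)

        -- The tower is a chain, so among the members containing the single entries one contains all
        -- of them. The empty list is set apart because `p` may select nothing.
        common : ∀ p → (∀ s → p s ≡ true → Tower s) → ∀ xs → All (_∈ˢ ⋃ p) xs →
                 xs ≡ [] ⊎ ∃[ s ] (p s ≡ true × All (_∈ˢ s) xs)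
        common p h []       []         = inj₁ refl
        common p h (x ∷ xs) (px ∷ pxs) with truth⁻ px | common p h xs pxs
        ... | s , ps , x∈s | inj₁ refl = inj₂ (s , ps , x∈s ∷ [])
        ... | s , ps , x∈s | inj₂ (t , pt , xs∈t) with tower-total (h s ps) (h t pt)
        ...   | inj₁ s⊑t = inj₂ (t , pt , s⊑t x x∈s ∷ xs∈t)
        ...   | inj₂ t⊑s = inj₂ (s , ps , x∈s ∷ All.map (λ {y} → t⊑s y) xs∈t)

        tower-consistent : ∀ {s} → Tower s → Consistent s
        tower-consistent (next t)  = extend-consistent _ em (tower-consistent t)
        tower-consistent (sup p h) xs xs∈ with common p h xs xs∈
        ... | inj₁ refl             = good[]
        ... | inj₂ (s , ps , xs∈s) = tower-consistent (h s ps) xs xs∈s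

        extend-closed : ∀ s d → extend s d ⊑ s → ¬ (∃[ x ] Extends s x)
        extend-closed s (no ¬x)             closed = ¬x
        extend-closed s (yes (x , x∉s , _)) closed = contradiction (closed x (truth⁺ (inj₂ refl))) x∉s

      -- Consistency is inherited along the tower up to `top`; since `extend` fixes `top`, no point
      -- outside it can be added consistently.
      teichmüller-tukey : ∃[ S ] ((∀ xs → All (_∈ˢ S) xs → Good xs) ×
                                  (∀ x → (∀ xs → All (_∈ˢ S) xs → Good (x ∷ xs)) → x ∈ˢ S))
      teichmüller-tukey = top , tower-consistent top-tower , λ x ok →
        stable λ x∉ → extend-closed top em top-fixed (x , x∉ , ok)

  -- Cluster points of nets in a product of two-point spaces.

  module _ {J : Set a} (_≤_ : J → J → Set b)
           (≤-trans : ∀ {i j k} → i ≤ j → j ≤ k → i ≤ k)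
           (directed : ∀ i j → ∃[ k ] (i ≤ k × j ≤ k))
           {E : Set c} (net : J → E → Bool) where

    private
      Frequent : List (E × Bool) → Set _
      Frequent xs = ∀ s → ∃[ r ] (s ≤ r × All (λ (e , v) → net r e ≡ v) xs)

      -- A maximal set of prescribed values whose finite parts are all attained frequently plays the
      -- role of an ultrafilter: it decides every coordinate, and `f` records the decisions.
      clusterPoint′ : Σ[ f ∈ (E → Bool) ] (∀ es s → ∃[ r ] (s ≤ r × All (λ e → net r e ≡ f e) es))
      clusterPoint′ with teichmüller-tukey Frequent
             (λ xs⊆ys freq s → let r , s≤r , h = freq s in r , s≤r , All.anti-mono xs⊆ys h)
             (λ s → let r , s≤r , _ = directed s s in r , s≤r , [])
      ... | S , consistent , maximal = f , λ es s →
          let r , s≤r , h = consistent (List.map (λ e → e , f e) es) (All.map⁺ (All.universal decided es)) s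
          in r , s≤r , All.map⁻ h
        where
        f : E → Bool
        f e = S (e , true)

        -- If `(e , false)` cannot join `S`, then for some finite `xs` in `S` and some `s`, the net
        -- beyond `s` is true at `e` whenever it matches `xs`; hence `(e , true)` can join.
        negative : ∀ e → ¬ (S (e , true) ≡ true) → S (e , false) ≡ true
        negative e e∉ = maximal _ λ xs xs∈ s → stable λ fails →
          e∉ (maximal _ λ ys ys∈ t →
            let k , s≤k , t≤k = directed s t
                r , k≤r , h   = consistent (xs ++ ys) (All.++⁺ xs∈ ys∈) k
            in r , ≤-trans t≤k k≤r
               , stable (λ ne → fails (r , ≤-trans s≤k k≤r
                                 , ¬-not (λ eq → ne (eq ∷ All.++⁻ʳ xs h)) ∷ All.++⁻ˡ xs h)))

        decided : ∀ e → S (e , f e) ≡ true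
        decided e with S (e , true) in eq
        ... | true  = eq
        ... | false = negative e λ eq′ → case trans (sym eq) eq′ of λ ()

    -- Tychonoff's theorem for {0,1}^E.
    abstract
      clusterPoint : Σ[ f ∈ (E → Bool) ] (∀ es s → ∃[ r ] (s ≤ r × All (λ e → net r e ≡ f e) es))
      clusterPoint = clusterPoint′

  -- Injective sequences in infinite types.

  module _ {A : Set a} (infinite : ¬ Finite A) where

    private
      fresh : ∀ (xs : List A) → Unique xs → ∃[ x ] (x ∉ xs)
      fresh xs unique = stable λ none → infinite
        (unique-enumeration⇒finite xs unique λ x → stable λ x∉xs → none (x , x∉xs))

      prefix : ℕ → Σ (List A) Unique
      prefix zero    = [] , []
      prefix (suc n) with prefix n
      ... | xs , unique = let x , x∉xs = fresh xs unique in x ∷ xs , All.¬Any⇒All¬ xs x∉xs ∷ unique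

      term : ℕ → A
      term n = proj₁ (fresh (proj₁ (prefix n)) (proj₂ (prefix n)))

      term∉ : ∀ n → term n ∉ proj₁ (prefix n)
      term∉ n = proj₂ (fresh (proj₁ (prefix n)) (proj₂ (prefix n)))

      term∈ : ∀ {m n} → m ℕ.<′ n → term m ∈ proj₁ (prefix n)
      term∈ ℕ.<′-base     = here refl
      term∈ (ℕ.<′-step p) = there (term∈ p)

      term-distinct : ∀ {m n} → m < n → ¬ (term m ≡ term n)
      term-distinct {m} {n} m<n eq = term∉ n (subst (_∈ _) eq (term∈ (ℕ.<⇒<′ m<n)))

    sequence : ∃[ u ] Injective {A = ℕ} {B = A} _≡_ _≡_ u
    sequence = term , λ {m} {n} eq → case ℕ.<-cmp m n of λ
      { (tri< m<n _ _) → contradiction eq (term-distinct m<n)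
      ; (tri≈ _ m≡n _) → m≡n
      ; (tri> _ _ n<m) → contradiction (sym eq) (term-distinct n<m) }
  
  -- Evaluating atoms in a finite structure.

  module _ {I : Set ℓ} {μ : I → ℕ} where

    -- Points of X may be undefined in r; a relation fails when one of its
    -- arguments is undefined.
    value : {X : Set a} (r : FinStructure μ) → (X → Maybe (Fin (FinStructure.size r))) → Atom μ X → Bool
    value r u (eqₐ x y)  = truth (u x ≡ u y)
    value r u (relₐ i v) = truth (∃[ w ] (map u v ≡ map just w × FinStructure.rel r i w ≡ true))

    value-rel : {X : Set a} (r : FinStructure μ) (u : X → Maybe (Fin (FinStructure.size r))) →
                ∀ i {v w} → map u v ≡ map just w → value r u (relₐ i v) ≡ FinStructure.rel r i w
    value-rel r u i {w = w} def = iff⇒≡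
      (λ val → let w′ , def′ , holds = truth⁻ val
               in subst (λ w → FinStructure.rel r i w ≡ true)
                    (map-injective just-injective (trans (sym def′) def)) holds)
      (λ holds → truth⁺ (w , def , holds))

  -- Representatives of classes.

  module _ {D : Set a} where

    -- For an inhabited class the result depends on `c` and the decision only, so with `em`
    -- equivalent points share a representative. The last argument is the default for an empty
    -- class.
    choose : (c : D → Bool) → Dec (∃[ d ] c d ≡ true) → D → D
    choose c (yes (d , _)) _ = d
    choose c (no _)        d = d

    choose-correct : (c : D → Bool) (dec : Dec (∃[ d ] c d ≡ true)) (d : D) → c d ≡ true → c (choose c dec d) ≡ true
    choose-correct c (yes (_ , holds)) _ _  = holds
    choose-correct c (no _)            _ cd = cd

    choose-constant : (c : D → Bool) (dec : Dec (∃[ d ] c d ≡ true)) (d d′ : D) →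
                      c d ≡ true → choose c dec d ≡ choose c dec d′
    choose-constant c (yes _) _ _  _  = refl
    choose-constant c (no ¬c) d d′ cd = contradiction (d , cd) ¬c

  -- Representing an ideal when finitely many relations are non-unary.

  module _ {I : Set ℓ} {μ : I → ℕ} (positive : ∀ i → NonZero (μ i))
           (nonUnary : Enumeration (∃[ i ] 2 ≤ μ i)) (𝒮 : 𝒥 (Ω μ)) where

    open IsIdeal (proj₂ 𝒮)
    open FinStructure using (size)

    private
      S : 𝔓 (Poset.Eq.setoid (Ω μ))
      S = proj₁ 𝒮

      Member : Set ℓ
      Member = ∃[ s ] s ∈ₚ S

      infix 4 _≼_
      _≼_ : Member → Member → Set ℓ
      s ≼ r = Embedding μ ⟦ proj₁ s ⟧ ⟦ proj₁ r ⟧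

      ≼-trans : ∀ {s t r} → s ≼ t → t ≼ r → s ≼ r
      ≼-trans f g = g ∘ₑ f

      directed : ∀ s t → ∃[ r ] (s ≼ r × t ≼ r)
      directed (s , s∈) (t , t∈) =
        let r , r∈ , s≤r , t≤r = upDirected s t s∈ t∈ in (r , r∈) , s≤r , t≤r

      Point : Set ℓ
      Point = Σ Member (Fin ∘ size ∘ proj₁)

      place : ∀ {s r} → Dec (s ≼ r) → Fin (size (proj₁ s)) → Maybe (Fin (size (proj₁ r)))
      place (yes e) k = just (Embedding.to e k)
      place (no _)  k = nothing

      -- `em` picks one embedding for each comparable pair of members. These choices need not be
      -- compatible with one another; the cluster point settles which identifications persist.
      locate : ∀ r → Point → Maybe (Fin (size (proj₁ r)))
      locate r (s , k) = place {s} {r} em k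

      place-defined : ∀ {s r} (d : Dec (s ≼ r)) → s ≼ r →
                      ∃[ e ] (∀ k → place {s} {r} d k ≡ just (Embedding.to {𝔄 = ⟦ proj₁ s ⟧} {𝔅 = ⟦ proj₁ r ⟧} e k))
      place-defined (yes e) _   = e , λ _ → refl
      place-defined (no ¬e) s≤r = contradiction s≤r ¬e

      val : Member → Atom μ Point → Bool
      val r = value (proj₁ r) (locate r)

      cluster = clusterPoint _≼_ (λ {s} {t} {r} → ≼-trans {s} {t} {r}) directed val

      f : Atom μ Point → Bool
      f = proj₁ cluster

      -- Any property of `f` that involves finitely many atoms can thus be checked in a single
      -- member, taken above any given one.
      agree : ∀ as s → ∃[ r ] (s ≼ r × All (λ x → val r x ≡ f x) as)
      agree = proj₂ cluster

      _~_ : Point → Point → Set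
      x ~ y = f (eqₐ x y) ≡ true

      ~⇒locate : ∀ {r x y} → val r (eqₐ x y) ≡ f (eqₐ x y) → x ~ y → locate r x ≡ locate r y
      ~⇒locate eq x~y = truth⁻ (trans eq x~y)

      locate⇒~ : ∀ {r x y} → val r (eqₐ x y) ≡ f (eqₐ x y) → locate r x ≡ locate r y → x ~ y
      locate⇒~ eq same = trans (sym eq) (truth⁺ same)

      ~-refl : ∀ x → x ~ x
      ~-refl x@(s , _) with agree (eqₐ x x ∷ []) s
      ... | r , _ , e ∷ [] = locate⇒~ {r} e refl

      ~-sym : ∀ {x y} → x ~ y → y ~ x
      ~-sym {x@(s , _)} {y} x~y with agree (eqₐ x y ∷ eqₐ y x ∷ []) s
      ... | r , _ , e ∷ e′ ∷ [] = locate⇒~ {r} e′ (sym (~⇒locate {r} e x~y))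

      ~-trans : ∀ {x y z} → x ~ y → y ~ z → x ~ z
      ~-trans {x@(s , _)} {y} {z} x~y y~z with agree (eqₐ x y ∷ eqₐ y z ∷ eqₐ x z ∷ []) s
      ... | r , _ , e ∷ e′ ∷ e″ ∷ [] =
        locate⇒~ {r} e″ (trans (~⇒locate {r} e x~y) (~⇒locate {r} e′ y~z))

      -- Every member above `s` locates the copy of `s` by an embedding, so it already gives the
      -- values of `s`.
      copy-rel : ∀ s i v → f (relₐ i (map (s ,_) v)) ≡ FinStructure.rel (proj₁ s) i v
      copy-rel s i v with agree (relₐ i (map (s ,_) v) ∷ []) s
      ... | r , s≤r , eq ∷ [] with place-defined {s} {r} em s≤r
      ...   | e , placed = trans (sym eq) (trans
              (value-rel (proj₁ r) (locate r) i
                (trans (sym (Vec.map-∘ (locate r) (s ,_) v))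
                (trans (Vec.map-cong placed v) (Vec.map-∘ just (Embedding.to e) v))))
              (sym (Embedding.preserves e i v)))

      copy-injective : ∀ s {k l} → (s , k) ~ (s , l) → k ≡ l
      copy-injective s {k} {l} k~l with agree (eqₐ (s , k) (s , l) ∷ []) s
      ... | r , s≤r , eq ∷ [] with place-defined {s} {r} em s≤r
      ...   | e , placed = Embedding.injective e (just-injective
              (trans (sym (placed k)) (trans (~⇒locate {r} eq k~l) (placed l))))

      bound : ∀ n (h : Fin n → Point) → ∃[ r ] (∀ k → proj₁ (h k) ≼ r)
      bound zero    h = nonEmpty , λ ()
      bound (suc n) h =
        let r , above      = bound n (h ∘ suc)
            t , h₀≤t , r≤t = directed (proj₁ (h zero)) r
        in t , λ { zero → h₀≤t ; (suc k) → r≤t ∘ₑ above k }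

      -- An upper bound of the members supplying the points locates all of them, and some member
      -- beyond it agrees with `f` on the finitely many atoms about them.
      realise : ∀ {n} (h : Fin n → Point) → Σ[ r ∈ Member ] Σ[ u ∈ (Fin n → Fin (size (proj₁ r))) ]
                ((∀ k l → u k ≡ u l → h k ~ h l) ×
                 (∀ i v → f (relₐ i (map h v)) ≡ FinStructure.rel (proj₁ r) i (map u v)))
      realise {n} h with bound n h
      ... | t , above with agree (List.map (mapAtom h) (atoms nonUnary (allFin n))) t
      ...   | r , t≤r , agreeing = r , u , injective , preserves
        where
        agreeing′ : All (λ x → val r (mapAtom h x) ≡ f (mapAtom h x)) (atoms nonUnary (allFin n))
        agreeing′ = All.map⁻ agreeing

        located : ∀ k → ∃[ e ] (∀ l → place {proj₁ (h k)} {r} em l ≡ just (Embedding.to e l))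
        located k = place-defined {proj₁ (h k)} {r} em (t≤r ∘ₑ above k)

        u : Fin n → Fin (size (proj₁ r))
        u k = Embedding.to (proj₁ (located k)) (proj₂ (h k))

        locate-h : ∀ k → locate r (h k) ≡ just (u k)
        locate-h k = proj₂ (located k) (proj₂ (h k))

        injective : ∀ k l → u k ≡ u l → h k ~ h l
        injective k l eq = locate⇒~ {r} (All.lookup agreeing′ (eq∈atoms nonUnary ∈-allFin k l))
          (trans (locate-h k) (trans (cong just eq) (sym (locate-h l))))

        open ≡-Reasoning

        preserves : ∀ i v → f (relₐ i (map h v)) ≡ FinStructure.rel (proj₁ r) i (map u v)
        preserves i v with em {P = 2 ≤ μ i}
        ... | yes 2≤μi = trans (sym (All.lookup agreeing′ (rel∈atoms nonUnary ∈-allFin i 2≤μi v)))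
              (value-rel (proj₁ r) (locate r) i (trans (sym (Vec.map-∘ (locate r) h v))
                (trans (Vec.map-cong locate-h v) (Vec.map-∘ just u v))))
        -- No agreement with `f` was arranged for unary relations. Here `f` takes on a point the
        -- value from its own member `s`, and the embedding of `s` into `r` carries that value over.
        ... | no ¬2≤μi with singleton-vector (≱2⇒≡1 {{positive i}} ¬2≤μi) v
        ...   | k , refl = begin
          f (relₐ i (map h (replicate _ k)))
            ≡⟨ cong (f ∘ relₐ i) (trans (Vec.map-replicate h k _) (sym (Vec.map-replicate (s ,_) x _))) ⟩
          f (relₐ i (map (s ,_) (replicate _ x)))
            ≡⟨ copy-rel s i _ ⟩
          FinStructure.rel (proj₁ s) i (replicate _ x)
            ≡⟨ Embedding.preserves e i _ ⟩
          FinStructure.rel (proj₁ r) i (map (Embedding.to e) (replicate _ x))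
            ≡⟨ cong (FinStructure.rel (proj₁ r) i)
                 (trans (Vec.map-replicate (Embedding.to e) x _) (sym (Vec.map-replicate u k _))) ⟩
          FinStructure.rel (proj₁ r) i (map u (replicate _ k)) ∎
          where
          s = proj₁ (h k)
          x = proj₂ (h k)
          e = proj₁ (located k)

      rep : Point → Point
      rep x = choose (λ y → f (eqₐ x y)) em x

      ~-rep : ∀ x → x ~ rep x
      ~-rep x = choose-correct (λ y → f (eqₐ x y)) em x (~-refl x)

      rep-cong : ∀ {x y} → x ~ y → rep x ≡ rep y
      rep-cong {x} {y} x~y = trans
        (cong (λ c → choose c em x) {x = λ z → f (eqₐ x z)} {y = λ z → f (eqₐ y z)}
          (ext λ z → iff⇒≡ (~-trans (~-sym x~y)) (~-trans x~y)))
        (choose-constant (λ z → f (eqₐ y z)) em x y (~-sym x~y))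

      -- A tuple has finitely many entries, so one member agrees with `f` on both atoms and on all
      -- equations between an entry and its representative; there the two tuples are located at the
      -- same place.
      rel-cong : ∀ i v → f (relₐ i v) ≡ f (relₐ i (map rep v))
      rel-cong i v with agree (relₐ i v ∷ relₐ i (map rep v) ∷ List.map (λ x → eqₐ x (rep x)) (toList v)) nonEmpty
      ... | r , _ , e ∷ e′ ∷ es = trans (sym e) (trans
            (cong (λ w → truth (∃[ w′ ] (w ≡ map just w′ × FinStructure.rel (proj₁ r) i w′ ≡ true)))
              (same v (All.map⁻ es))) e′)
        where
        same : ∀ {n} (v : Vec Point n) → All (λ x → val r (eqₐ x (rep x)) ≡ f (eqₐ x (rep x))) (toList v) →
               map (locate r) v ≡ map (locate r) (map rep v)
        same []      []       = refl
        same (x ∷ v) (p ∷ ps) = cong₂ _∷_ (~⇒locate {r} p (~-rep x)) (same v ps)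

      -- The quotient of `Point` by `_~_`, realised on chosen representatives because embeddings
      -- refer to propositional equality of the carrier.
      limit : Structure μ ℓ
      limit = record
        { Carrier = ∃[ x ] rep x ≡ x
        ; rel     = λ i v → f (relₐ i (map proj₁ v))
        }

      member-embeds : ∀ s → Embedding μ ⟦ proj₁ s ⟧ limit
      member-embeds s = record
        { to        = λ k → rep (s , k) , sym (rep-cong (~-rep (s , k)))
        ; injective = λ {k} {l} eq → copy-injective s (~-trans (~-rep (s , k))
            (subst (λ x → x ~ (s , l)) (sym (cong proj₁ eq)) (~-sym (~-rep (s , l)))))
        ; preserves = λ i v → trans (sym (copy-rel s i v)) (trans (rel-cong i _)
            (cong (f ∘ relₐ i) (trans (sym (Vec.map-∘ rep (s ,_) v)) (Vec.map-∘ proj₁ _ v))))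
        }

      embeds-member : ∀ σ → Embedding μ ⟦ σ ⟧ limit → σ ∈ₚ S
      embeds-member σ e =
        let r , u , inj , pres = realise (proj₁ ∘ to)
        in downClosed σ (proj₁ r) record
             { to        = u
             ; injective = λ {k} {l} eq → injective (fixed-≡
                 (trans (sym (proj₂ (to k))) (trans (rep-cong (inj k l eq)) (proj₂ (to l)))))
             ; preserves = λ i v → trans (preserves i v)
                 (trans (cong (f ∘ relₐ i) (sym (Vec.map-∘ proj₁ to v))) (pres i v))
             } (proj₂ r)
        where open Embedding e

    ideal-representable : Representable μ 𝒮
    ideal-representable = limit , λ σ → mk⇔
      (embeds-member σ ∘ Equivalence.to (age⇔embeds limit σ))
      (λ σ∈ → Equivalence.from (age⇔embeds limit σ) (member-embeds (σ , σ∈)))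

  -- Compactness of the space of ideals when finitely many relations are non-unary.

  module _ {I : Set ℓ} {μ : I → ℕ} (positive : ∀ i → NonZero (μ i)) where

    open FinStructure

    no-vectors : ∀ i → ¬ Vec (Fin 0) (μ i)
    no-vectors i v = absurd {{positive i}} v
      where
      absurd : ∀ {n} → {{NonZero n}} → ¬ Vec (Fin 0) n
      absurd {suc n} (() ∷ _)

    emptyStructure : FinStructure μ
    emptyStructure = record { size = 0 ; rel = λ _ _ → false }

    empty-least : (𝔄 : Structure μ b) → Embedding μ ⟦ emptyStructure ⟧ 𝔄
    empty-least 𝔄 = record
      { to = λ () ; injective = λ {} ; preserves = λ i v → contradiction v (no-vectors i) }

    module _ (nonUnary : Enumeration (∃[ i ] 2 ≤ μ i)) where

      module _ (p q : FinStructure μ) where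

        Named : Set
        Named = Fin (size p) ⊎ Fin (size q)

        names : List Named
        names = List.map inj₁ (allFin (size p)) ++ List.map inj₂ (allFin (size q))

        ∈-names : ∀ x → x ∈ names
        ∈-names (inj₁ k) = ∈-++⁺ˡ (∈-map⁺ inj₁ (∈-allFin k))
        ∈-names (inj₂ k) = ∈-++⁺ʳ (List.map inj₁ (allFin (size p))) (∈-map⁺ inj₂ (∈-allFin k))

        record Cospan : Set ℓ where
          field
            apex  : FinStructure μ
            left  : Embedding μ ⟦ p ⟧ ⟦ apex ⟧
            right : Embedding μ ⟦ q ⟧ ⟦ apex ⟧

          name : Named → Fin (size apex)
          name = [ Embedding.to left , Embedding.to right ]′

          holds : Atom μ Named → Bool
          holds = value apex (just ∘ name)

          image : List (Fin (size apex))
          image = deduplicate Fin._≟_ (List.map name names)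

          image-unique : Unique image
          image-unique = Unique.deduplicate-! Fin._≟_ (List.map name names)

          name∈image : ∀ x → name x ∈ image
          name∈image x = ∈-deduplicate⁺ Fin._≟_ (∈-map⁺ name (∈-names x))

          image-named : ∀ k → ∃[ x ] lookup image k ≡ name x
          image-named k =
            let x , _ , eq = ∈-map⁻ name (∈-deduplicate⁻ Fin._≟_ (List.map name names) (∈-lookup k))
            in x , eq

          generated : FinStructure μ
          generated = ⟦ apex ⟧ ↾ image

          left≤generated : Embedding μ ⟦ p ⟧ ⟦ generated ⟧
          left≤generated = restrict ⟦ apex ⟧ left (name∈image ∘ inj₁)

          right≤generated : Embedding μ ⟦ q ⟧ ⟦ generated ⟧
          right≤generated = restrict ⟦ apex ⟧ right (name∈image ∘ inj₂)

        open Cospan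

        loop-preserved : ∀ {s r : FinStructure μ} (e : Embedding μ ⟦ s ⟧ ⟦ r ⟧) → ∀ i k →
                   rel r i (replicate _ (Embedding.to e k)) ≡ rel s i (replicate _ k)
        loop-preserved {r = r} e i k = trans (cong (rel r i) (sym (Vec.map-replicate (Embedding.to e) k _)))
                                       (sym (Embedding.preserves e i _))

        -- A named point comes from `p` or `q`, and its constant tuples are evaluated there,
        -- independently of the cospan. This covers the unary relations.
        loop-agree : (A B : Cospan) → ∀ i x →
                     rel (apex A) i (replicate _ (name A x)) ≡ rel (apex B) i (replicate _ (name B x))
        loop-agree A B i (inj₁ k) =
          trans (loop-preserved {p} {apex A} (left A) i k) (sym (loop-preserved {p} {apex B} (left B) i k))
        loop-agree A B i (inj₂ k) =
          trans (loop-preserved {q} {apex A} (right A) i k) (sym (loop-preserved {q} {apex B} (right B) i k))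

        module _ (A B : Cospan) (agree : All (λ x → holds A x ≡ holds B x) (atoms nonUnary names)) where

          rel-agree : ∀ i v → rel (apex A) i (map (name A) v) ≡ rel (apex B) i (map (name B) v)
          rel-agree i v with em {P = 2 ≤ μ i}
          ... | yes 2≤μi = trans (sym (evaluate A)) (trans
                  (All.lookup agree (rel∈atoms nonUnary ∈-names i 2≤μi v)) (evaluate B))
            where
            evaluate : ∀ C → holds C (relₐ i v) ≡ rel (apex C) i (map (name C) v)
            evaluate C = value-rel (apex C) (just ∘ name C) i (Vec.map-∘ just (name C) v)
          ... | no ¬2≤μi with singleton-vector (≱2⇒≡1 {{positive i}} ¬2≤μi) v
          ...   | x , refl = trans (cong (rel (apex A) i) (Vec.map-replicate (name A) x _))
                  (trans (loop-agree A B i x)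
                  (cong (rel (apex B) i) (sym (Vec.map-replicate (name B) x _))))

          -- Every point of `generated A` has a name, and reading the name in `apex B` is the
          -- embedding. The listed atoms settle equality and the non-unary relations between names.
          generated-transfer : Embedding μ ⟦ generated A ⟧ ⟦ apex B ⟧
          generated-transfer = record
            { to        = name B ∘ source
            ; injective = λ {k} {l} eq → unique-lookup-injective (image-unique A)
                (trans (lookup-source k) (trans (same (source k) (source l) eq) (sym (lookup-source l))))
            ; preserves = λ i v → trans
                (cong (rel (apex A) i) (trans (Vec.map-cong lookup-source v) (Vec.map-∘ (name A) source v)))
                (trans (rel-agree i (map source v)) (cong (rel (apex B) i) (sym (Vec.map-∘ (name B) source v))))
            }
            where
            source : Fin (size (generated A)) → Named
            source k = proj₁ (image-named A k)
            lookup-source : ∀ k → lookup (image A) k ≡ name A (source k)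
            lookup-source k = proj₂ (image-named A k)
            same : ∀ x y → name B x ≡ name B y → name A x ≡ name A y
            same x y eq = just-injective (truth⁻ (trans
              (All.lookup agree (eq∈atoms nonUnary ∈-names x y)) (truth⁺ (cong just eq))))

      open Cospan

      module _ (𝒮 : 𝒥 (Ω μ)) (p q : FinStructure μ) where

        private
          S : 𝔓 (Poset.Eq.setoid (Ω μ))
          S = proj₁ 𝒮

        cospan : p ∈ₚ S → q ∈ₚ S → Σ[ A ∈ Cospan p q ] (apex A ∈ₚ S)
        cospan p∈ q∈ =
          let r , r∈ , e , e′ = IsIdeal.upDirected (proj₂ 𝒮) p q p∈ q∈
          in record { apex = r ; left = e ; right = e′ } , r∈

        cospanHolds : Dec (p ∈ₚ S × q ∈ₚ S) → Atom μ (Named p q) → Bool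
        cospanHolds (yes (p∈ , q∈)) x = holds (proj₁ (cospan p∈ q∈)) x
        cospanHolds (no _)          _ = false

        cospanHolds-cospan : ∀ d → p ∈ₚ S → q ∈ₚ S →
          Σ[ A ∈ Cospan p q ] (apex A ∈ₚ S × (∀ x → cospanHolds d x ≡ holds A x))
        cospanHolds-cospan (yes (p∈ , q∈)) _  _  = let A , A∈ = cospan p∈ q∈ in A , A∈ , λ _ → refl
        cospanHolds-cospan (no ¬pq)        p∈ q∈ = contradiction (p∈ , q∈) ¬pq

      module _ {J : Set b} (ideal : List J → 𝒥 (Ω μ)) where

        private
          -- Up-directedness is existential, and membership alone does not carry it to a limit. The
          -- second kind of coordinate follows the atoms of the cospan chosen in each ideal, so that
          -- the limit fixes the shape of an amalgam.
          Coordinate : Set ℓ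
          Coordinate = FinStructure μ ⊎ (Σ[ p ∈ FinStructure μ ] Σ[ q ∈ FinStructure μ ] Atom μ (Named p q))

          coordinate : 𝒥 (Ω μ) → Coordinate → Bool
          coordinate 𝒮 (inj₁ σ)           = Func.to (proj₁ 𝒮) σ
          coordinate 𝒮 (inj₂ (p , q , x)) = cospanHolds 𝒮 p q em x

          cluster = clusterPoint {J = List J} _⊆_ (λ f g → g ∘ f)
            (λ js ks → js ++ ks , ∈-++⁺ˡ , ∈-++⁺ʳ js) (coordinate ∘ ideal)

          f : Coordinate → Bool
          f = proj₁ cluster

          agree : ∀ es js → ∃[ ks ] (js ⊆ ks × All (λ e → coordinate (ideal ks) e ≡ f e) es)
          agree = proj₂ cluster

          limit : 𝔓 (Poset.Eq.setoid (Ω μ))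
          limit = record { to = f ∘ inj₁ ; cong = λ {σ} {τ} σ≅τ →
            let ks , _ , hs = agree (inj₁ σ ∷ inj₁ τ ∷ []) []
            in trans (sym (All.head hs)) (trans (Func.cong (proj₁ (ideal ks)) σ≅τ) (All.head (All.tail hs))) }

          -- The witness is generated by the images of `p` and `q` in an amalgam whose atoms are
          -- those prescribed by the limit.
          limit-upDirected : ∀ p q → p ∈ₚ limit → q ∈ₚ limit →
                             ∃[ r ] (r ∈ₚ limit × Embedding μ ⟦ p ⟧ ⟦ r ⟧ × Embedding μ ⟦ q ⟧ ⟦ r ⟧)
          limit-upDirected p q p∈ q∈
            with agree (inj₁ p ∷ inj₁ q ∷ List.map (λ x → inj₂ (p , q , x)) (atoms nonUnary (names p q))) []
          ... | ks , _ , hp ∷ hq ∷ hs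
            with cospanHolds-cospan (ideal ks) p q em (trans hp p∈) (trans hq q∈)
          -- Only now is `generated A` known, so a second ideal is taken that also agrees with the
          -- limit on its membership. Its cospan `B` has the same atoms, so `generated A` embeds in
          -- `apex B` and belongs to that ideal.
          ... | A , A∈ , A-holds
            with agree (inj₁ (generated A) ∷ inj₁ p ∷ inj₁ q
                      ∷ List.map (λ x → inj₂ (p , q , x)) (atoms nonUnary (names p q))) []
          ... | ls , _ , hc ∷ hp′ ∷ hq′ ∷ hs′
            with cospanHolds-cospan (ideal ls) p q em (trans hp′ p∈) (trans hq′ q∈)
          ... | B , B∈ , B-holds = generated A , trans (sym hc)
                  (IsIdeal.downClosed (proj₂ (ideal ls)) (generated A) (apex B)
                    (generated-transfer p q A B agreeing) B∈)
                , left≤generated A , right≤generated A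
            where
            agreeing : All (λ x → holds A x ≡ holds B x) (atoms nonUnary (names p q))
            agreeing = All.zipWith
              (λ {x} (h , h′) → trans (sym (A-holds x)) (trans h (trans (sym h′) (B-holds x))))
              (All.map⁻ hs , All.map⁻ hs′)

          limit-ideal : IsIdeal (Ω μ) limit
          limit-ideal = record
            -- For a down-closed set, being non-empty amounts to containing the empty structure.
            -- This is a condition on one coordinate and so passes to the limit.
            { nonEmpty   = emptyStructure ,
                (let ks , _ , hs = agree (inj₁ emptyStructure ∷ []) []
                     open IsIdeal (proj₂ (ideal ks))
                 in trans (sym (All.head hs)) (downClosed _ _ (empty-least ⟦ proj₁ nonEmpty ⟧) (proj₂ nonEmpty)))
            ; downClosed = λ p q p≤q q∈ →
                let ks , _ , hs = agree (inj₁ p ∷ inj₁ q ∷ []) []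
                in trans (sym (All.head hs))
                     (IsIdeal.downClosed (proj₂ (ideal ks)) p q p≤q (trans (All.head (All.tail hs)) q∈))
            ; upDirected = limit-upDirected
            }

        ideals-cluster : Σ[ 𝒯 ∈ 𝒥 (Ω μ) ] (∀ σs js → ∃[ ks ] (js ⊆ ks ×
                           All (λ σ → Func.to (proj₁ 𝒯) σ ≡ Func.to (proj₁ (ideal ks)) σ) σs))
        ideals-cluster = (limit , limit-ideal) , λ σs js →
          let ks , js⊆ks , hs = agree (List.map inj₁ σs) js
          in ks , js⊆ks , All.map sym (All.map⁻ hs)

      -- Otherwise every finite list misses some ideal. These ideals form a net; a cluster point
      -- lies in some `U j`, and so does a nearby ideal of the net whose list contains `j`.
      ideals-compact : Compact (𝒥-topology (Ω μ))
      ideals-compact {J} U isOpen covers = stable λ noSubcover →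
        let missed : ∀ js → ∃[ 𝒮 ] ¬ Any (λ j → U j 𝒮) js
            missed js = stable λ none → noSubcover
              (js , λ 𝒮 → stable λ ¬any → none (𝒮 , ¬any))
            𝒯 , agree           = ideals-cluster (proj₁ ∘ missed)
            j , 𝒯∈Uj            = covers 𝒯
            V , V-open , U⊆V , V⊆U = isOpen j
            σs , near           = V-open (proj₁ 𝒯) (U⊆V 𝒯∈Uj)
            ks , j∈ks , same    = agree σs (j ∷ [])
        in proj₂ (missed ks)
             (Any.map (λ { refl → V⊆U {proj₁ (missed ks)} (near (proj₁ (proj₁ (missed ks))) same) })
               (j∈ks (here refl)))

  -- Cantor's diagonal argument.

  cantor : (Code : ℕ → (ℕ → Bool) → Set a) → (∀ α → ∃[ k ] Code k α) →
           ¬ (∀ {k α β} → Code k α → Code k β → α ≡ β)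
  cantor Code total injective = case truth⁻ diagonal-true of λ (α , code , αk≡false) →
    case trans (sym αk≡false)
           (trans (cong (λ γ → γ k) (injective code (proj₂ (total diagonal)))) diagonal-true) of λ ()
    where
    -- Where `k` codes a sequence `α`, unique by `injective`, the value at `k` is opposite to `α k`;
    -- so no `k` can code `diagonal` itself.
    diagonal : ℕ → Bool
    diagonal k = truth (∃[ α ] (Code k α × α k ≡ false))
    k = proj₁ (total diagonal)
    diagonal-true : diagonal k ≡ true
    diagonal-true with diagonal k in eq
    ... | true  = refl
    ... | false = trans (sym eq) (truth⁺ (diagonal , proj₂ (total diagonal) , eq))

  -- Infinitely many non-unary relations as edge labels.

  module _ {I : Set ℓ} {μ : I → ℕ} (positive : ∀ i → NonZero (μ i)) where

    open FinStructure

    principal : FinStructure μ → 𝒥 (Ω μ)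
    principal r = record
        { to   = λ σ → truth (Embedding μ ⟦ σ ⟧ ⟦ r ⟧)
        ; cong = λ σ≅τ → truth-cong (λ e → _∘ₑ_ e (proj₁ (≅-sym σ≅τ))) (λ e → _∘ₑ_ e (proj₁ σ≅τ))
        } , record
        { nonEmpty   = r , truth⁺ idₑ
        ; downClosed = λ p q p≤q q∈ → truth⁺ (_∘ₑ_ (truth⁻ q∈) p≤q)
        ; upDirected = λ p q p∈ q∈ → r , truth⁺ idₑ , truth⁻ p∈ , truth⁻ q∈
        }

    module _ (label : ℕ → ∃[ i ] 2 ≤ μ i) (label-injective : Injective _≡_ _≡_ label) where

      ix : ℕ → I
      ix = proj₁ ∘ label

      ix-binary : ∀ n → 2 ≤ μ (ix n)
      ix-binary = proj₂ ∘ label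

      ix-injective : Injective _≡_ _≡_ ix
      ix-injective {m} {n} eq = label-injective (same (label m) (label n) eq)
        where
        same : (x y : ∃[ i ] 2 ≤ μ i) → proj₁ x ≡ proj₁ y → x ≡ y
        same (_ , p) (_ , q) refl = cong (_ ,_) (ℕ.≤-irrelevant p q)

      edge : (𝔄 : Structure μ a) → ℕ → Structure.Carrier 𝔄 → Structure.Carrier 𝔄 → Bool
      edge 𝔄 n x y = Structure.rel 𝔄 (ix n) (pair x y)

      edge-preserved : {𝔄 : Structure μ a} {𝔅 : Structure μ b} (e : Embedding μ 𝔄 𝔅) →
                       ∀ n x y → edge 𝔄 n x y ≡ edge 𝔅 n (Embedding.to e x) (Embedding.to e y)
      edge-preserved {𝔅 = 𝔅} e n x y =
        trans (Embedding.preserves e (ix n) _) (cong (Structure.rel 𝔅 (ix n)) (map-pair (Embedding.to e) x y))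

      module _ {A : Set} where

        -- The tuples `v` and `pair x y` have lengths `μ i` and `μ (ix n)`, so they are compared
        -- together with their indices in the total space.
        IsEdge : (P : ℕ → A → A → Set) → ∀ i → Vec A (μ i) → Set ℓ
        IsEdge P i v = ∃[ n ] ∃[ x ] ∃[ y ] (P n x y × _≡_ {A = Σ I (Vec A ∘ μ)} (i , v) (ix n , pair x y))

        isEdge⁻ : ∀ P {n x y} → IsEdge P (ix n) (pair x y) → P n x y
        isEdge⁻ P {n} (m , x′ , y′ , p , eq) with ix-injective {n} {m} (cong proj₁ eq)
        ... | refl with pair-injective (ix-binary n) (dependent-injective {B = Vec A ∘ μ} eq)
        ...   | refl , refl = p

      isEdge-map⁻ : {A B : Set} {f : A → B} → Injective _≡_ _≡_ f → ∀ Q i v → IsEdge Q i (map f v) →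
                    ∃[ n ] ∃[ x ] ∃[ y ] (Q n (f x) (f y) × _≡_ {A = Σ I (Vec A ∘ μ)} (i , v) (ix n , pair x y))
      isEdge-map⁻ {A} {B} {f} inj Q i v (n , x , y , q , eq) = pull i v (cong proj₁ eq) eq
        where
        pull : ∀ i v → i ≡ ix n → _≡_ {A = Σ I (Vec B ∘ μ)} (i , map f v) (ix n , pair x y) →
               ∃[ n ] ∃[ x ] ∃[ y ] (Q n (f x) (f y) × _≡_ {A = Σ I (Vec A ∘ μ)} (i , v) (ix n , pair x y))
        pull i v refl eq with unpair inj (ix-binary n) v (dependent-injective {B = Vec B ∘ μ} eq)
        ... | x′ , y′ , refl , refl , refl = n , x′ , y′ , q , refl

      spanned : ∀ k → (ℕ → Fin k → Fin k → Set) → FinStructure μ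
      spanned k P = record { size = k ; rel = λ i v → truth (IsEdge P i v) }

      spanned-edge⁺ : ∀ {k} P {n} {x y : Fin k} → P n x y → edge ⟦ spanned k P ⟧ n x y ≡ true
      spanned-edge⁺ P p = truth⁺ (_ , _ , _ , p , refl)

      spanned-edge⁻ : ∀ {k} P {n} {x y : Fin k} → edge ⟦ spanned k P ⟧ n x y ≡ true → P n x y
      spanned-edge⁻ P eq = isEdge⁻ P (truth⁻ eq)

      spanned-embedding : ∀ {k l P Q} (f : Fin k → Fin l) → Injective _≡_ _≡_ f →
        (∀ {n x y} → P n x y → Q n (f x) (f y)) → (∀ {n x y} → Q n (f x) (f y) → P n x y) →
        Embedding μ ⟦ spanned k P ⟧ ⟦ spanned l Q ⟧
      spanned-embedding {k} {l} {P} {Q} f inj P⇒Q Q⇒P = record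
        { to        = f
        ; injective = inj
        ; preserves = λ i v → truth-cong (forward i v)
            λ edge → let n , x , y , q , eq = isEdge-map⁻ inj Q i v edge in n , x , y , Q⇒P q , eq
        }
        where
        forward : ∀ i v → IsEdge P i v → IsEdge Q i (map f v)
        forward i v (n , x , y , p , refl) = n , f x , f y , P⇒Q p , cong (ix n ,_) (map-pair f x y)

      -- Failure of compactness.

      -- Label 0 is spent on the loop telling the two points apart.
      looseP loopP : ℕ → Fin 1 → Fin 1 → Set
      looseP _ _ _ = ⊥
      loopP n _ _  = n ≡ 0

      arrowP : ℕ → ℕ → Fin 2 → Fin 2 → Set
      arrowP n m x y = (m ≡ 0 × x ≡ 1F × y ≡ 1F) ⊎ (m ≡ suc n × x ≡ 0F × y ≡ 1F)

      loose loop : FinStructure μ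
      loose = spanned 1 looseP
      loop  = spanned 1 loopP

      arrow : ℕ → FinStructure μ
      arrow n = spanned 2 (arrowP n)

      loose≤arrow : ∀ n → Embedding μ ⟦ loose ⟧ ⟦ arrow n ⟧
      loose≤arrow n = spanned-embedding {P = looseP} {Q = arrowP n} (const 0F) (λ _ → fin1-unique _ _) (λ ())
        λ { (inj₁ (_ , () , _)) ; (inj₂ (_ , _ , ())) }

      loop≤arrow : ∀ n → Embedding μ ⟦ loop ⟧ ⟦ arrow n ⟧
      loop≤arrow n = spanned-embedding {P = loopP} {Q = arrowP n} (const 1F) (λ _ → fin1-unique _ _)
        (λ m≡0 → inj₁ (m≡0 , refl , refl)) λ { (inj₁ (m≡0 , _)) → m≡0 ; (inj₂ (_ , () , _)) }

      module _ {s : FinStructure μ} (f : Embedding μ ⟦ loose ⟧ ⟦ s ⟧) (g : Embedding μ ⟦ loop ⟧ ⟦ s ⟧) where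

        private
          x y : Fin (size s)
          x = Embedding.to f 0F
          y = Embedding.to g 0F

        module _ {n} (e : Embedding μ ⟦ s ⟧ ⟦ arrow n ⟧) where
          open Embedding e

          y↦1 : to y ≡ 1F
          y↦1 with spanned-edge⁻ (arrowP n)
                 (trans (sym (edge-preserved (_∘ₑ_ e g) 0 0F 0F)) (spanned-edge⁺ loopP {0} refl))
          ... | inj₁ (_ , eq , _) = eq
          ... | inj₂ (_ , _ , eq) = eq

          x↦0 : to x ≡ 0F
          x↦0 with to x in eq
          ... | 0F = refl
          ... | 1F = ⊥-elim (spanned-edge⁻ looseP {0} (trans (edge-preserved (_∘ₑ_ e f) 0 0F 0F)
                       (subst (λ z → edge ⟦ arrow n ⟧ 0 z z ≡ true) (sym eq)
                         (spanned-edge⁺ (arrowP n) (inj₁ (refl , refl , refl))))))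

          arrow-edge : ∀ m → edge ⟦ s ⟧ m x y ≡ edge ⟦ arrow n ⟧ m 0F 1F
          arrow-edge m = trans (edge-preserved e m x y) (cong₂ (edge ⟦ arrow n ⟧ m) x↦0 y↦1)

        -- An embedding into an arrow has to send the looped point to `1F` and the loose one to
        -- `0F`. The label of the edge between them is then visible in `s` already.
        arrow-unique : ∀ {m n} → Embedding μ ⟦ s ⟧ ⟦ arrow m ⟧ → Embedding μ ⟦ s ⟧ ⟦ arrow n ⟧ → m ≡ n
        arrow-unique {m} {n} e e′
          with spanned-edge⁻ (arrowP n) {suc m} {0F} {1F} (trans (sym (arrow-edge e′ (suc m)))
                 (trans (arrow-edge e (suc m)) (spanned-edge⁺ (arrowP m) (inj₂ (refl , refl , refl)))))
        ... | inj₁ (() , _)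
        ... | inj₂ (refl , _) = refl

      -- The cover consists of the ideals missing `loose` or `loop` and, for each `s` above both,
      -- the ideals containing `s`. An ideal generated by an arrow is never of the first kind, and
      -- each `s` catches at most one arrow.
      not-compact : ¬ Compact (𝒥-topology (Ω μ))
      not-compact compact =
        let js , finite-cover = compact U isOpen covers
            N , escapes       = escape js
        in escapes N ℕ.≤-refl (finite-cover (principal (arrow N)))
        where
        Cospans : Set ℓ
        Cospans = Σ[ s ∈ FinStructure μ ] (Embedding μ ⟦ loose ⟧ ⟦ s ⟧ × Embedding μ ⟦ loop ⟧ ⟦ s ⟧)

        V : Maybe Cospans → 𝔓 (Poset.Eq.setoid (Ω μ)) → Set ℓ
        V nothing        S = Lift ℓ (¬ (loose ∈ₚ S × loop ∈ₚ S))
        V (just (s , _)) S = Lift ℓ (s ∈ₚ S)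

        U : Maybe Cospans → 𝒥 (Ω μ) → Set ℓ
        U j = V j ∘ proj₁

        isOpen : ∀ j → 𝒥-topology (Ω μ) (U j)
        isOpen j = V j , V-open j , id , id
          where
          V-open : ∀ j → ProductTopology (Poset.Eq.setoid (Ω μ)) (V j)
          V-open nothing S (lift ¬both) = loose ∷ loop ∷ [] , λ { T (eq ∷ eq′ ∷ []) →
            lift λ (loose∈ , loop∈) → ¬both (trans eq loose∈ , trans eq′ loop∈) }
          V-open (just (s , _)) S (lift s∈) = s ∷ [] , λ { T (eq ∷ []) → lift (trans (sym eq) s∈) }

        covers : ∀ 𝒮 → ∃[ j ] U j 𝒮
        covers (S , ideal) with em {P = loose ∈ₚ S × loop ∈ₚ S}
        ... | no ¬both = nothing , lift ¬both
        ... | yes (loose∈ , loop∈) =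
          let s , s∈ , e , e′ = IsIdeal.upDirected ideal loose loop loose∈ loop∈
          in just (s , e , e′) , lift s∈

        escape : ∀ js → ∃[ N ] (∀ n → N ≤ n → ¬ Any (λ j → U j (principal (arrow n))) js)
        escape []            = 0 , λ _ _ ()
        escape (nothing ∷ js) =
          let N , escapes = escape js
          in N , λ { n N≤n (here (lift ¬both)) → ¬both (truth⁺ (loose≤arrow n) , truth⁺ (loop≤arrow n))
                   ; n N≤n (there any)         → escapes n N≤n any }
        escape (just (s , e , e′) ∷ js) with escape js | em {P = ∃[ m ] Embedding μ ⟦ s ⟧ ⟦ arrow m ⟧}
        ... | N , escapes | no never =
          N , λ { n N≤n (here (lift s∈)) → never (n , truth⁻ s∈)
                ; n N≤n (there any)      → escapes n N≤n any }
        ... | N , escapes | yes (m , s≤m) =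
          -- From `suc m` on, `arrow-unique` keeps `s` out of `principal (arrow n)`; `N` takes care
          -- of the rest of the list.
          suc m ℕ.⊔ N , λ { n N≤n (here (lift s∈)) → ℕ.<⇒≢ (ℕ.≤-trans (ℕ.m≤m⊔n (suc m) N) N≤n)
                              (arrow-unique e e′ s≤m (truth⁻ s∈))
                          ; n N≤n (there any) → escapes n (ℕ.≤-trans (ℕ.m≤n⊔m (suc m) N) N≤n) any }

      -- Properly edge-coloured structures and failure of representability.

      -- Loops are exempt: they encode the subset of ℕ marking a point.
      record Coloured (𝔄 : Structure μ a) : Set a where
        private E = edge 𝔄
        field
          colour : ∀ {x y} → x ≢ y → ∃[ n ] (E n x y ≡ true × (∀ m → E m x y ≡ true → m ≡ n))
          proper : ∀ {n x y z} → y ≢ x → z ≢ x → E n x y ≡ true → E n x z ≡ true → y ≡ z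

      coloured-hereditary : {𝔄 : Structure μ a} {𝔅 : Structure μ b} →
                            Embedding μ 𝔄 𝔅 → Coloured 𝔅 → Coloured 𝔄
      coloured-hereditary e coloured = record
        { colour = λ x≢y → let n , holds , only = colour (x≢y ∘ injective) in
            n , trans (edge-preserved e _ _ _) holds , λ m holds′ → only m (trans (sym (edge-preserved e _ _ _)) holds′)
        ; proper = λ y≢x z≢x exy exz → injective (proper (y≢x ∘ injective) (z≢x ∘ injective)
            (trans (sym (edge-preserved e _ _ _)) exy) (trans (sym (edge-preserved e _ _ _)) exz))
        }
        where
        open Coloured coloured
        open Embedding e

      -- The bound leaves infinitely many colours free for the edges between the two sides of an
      -- amalgam.
      colours-bounded : ∀ {σ} → Coloured ⟦ σ ⟧ → ∃[ N ] (∀ {x y} n → x ≢ y → edge ⟦ σ ⟧ n x y ≡ true → n < N)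
      colours-bounded {σ} coloured =
        let N , below = uniform-bound (size σ) (λ x n → ∃[ y ] (x ≢ y × edge ⟦ σ ⟧ n x y ≡ true)) λ x →
              let N , below = uniform-bound (size σ) (λ y n → x ≢ y × edge ⟦ σ ⟧ n x y ≡ true) (bound x)
              in N , λ n (y , p) → below y n p
        in N , λ n x≢y holds → below _ n (_ , x≢y , holds)
        where
        bound : ∀ x y → ∃[ N ] (∀ n → x ≢ y × edge ⟦ σ ⟧ n x y ≡ true → n < N)
        bound x y with em {P = x ≢ y}
        ... | yes x≢y = let N , _ , only = Coloured.colour coloured x≢y in
              suc N , λ n (_ , holds) → s≤s (ℕ.≤-reflexive (only n holds))
        ... | no ¬x≢y = 0 , λ n (x≢y , _) → contradiction x≢y ¬x≢y

      module Amalgam (σ τ : FinStructure μ) (σ-coloured : Coloured ⟦ σ ⟧) (τ-coloured : Coloured ⟦ τ ⟧) where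

        private
          module σ = Coloured σ-coloured
          module τ = Coloured τ-coloured

        N : ℕ
        N = proj₁ (colours-bounded σ-coloured) ℕ.⊔ proj₁ (colours-bounded τ-coloured)

        σ-below : ∀ {x y} n → x ≢ y → edge ⟦ σ ⟧ n x y ≡ true → n < N
        σ-below n x≢y holds = ℕ.<-≤-trans (proj₂ (colours-bounded σ-coloured) n x≢y holds) (ℕ.m≤m⊔n _ _)

        τ-below : ∀ {x y} n → x ≢ y → edge ⟦ τ ⟧ n x y ≡ true → n < N
        τ-below n x≢y holds = ℕ.<-≤-trans (proj₂ (colours-bounded τ-coloured) n x≢y holds)
          (ℕ.m≤n⊔m (proj₁ (colours-bounded σ-coloured)) _)

        Point : Set
        Point = Fin (size σ) ⊎ Fin (size τ)

        -- The target determines the colour. Starting at `N` avoids the colours inside either side,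
        -- and edges leaving a common point for distinct targets on the other side get distinct
        -- colours, as `proper` demands.
        Cross : ℕ → Point → Point → Set
        Cross n (inj₁ _) (inj₁ _) = ⊥
        Cross n (inj₁ _) (inj₂ y) = n ≡ N + toℕ y
        Cross n (inj₂ _) (inj₁ y) = n ≡ N + toℕ y
        Cross n (inj₂ _) (inj₂ _) = ⊥

        Holds : ∀ i → Vec Point (μ i) → Set ℓ
        Holds i v = (∃[ w ] (v ≡ map inj₁ w × rel σ i w ≡ true))
                  ⊎ (∃[ w ] (v ≡ map inj₂ w × rel τ i w ≡ true))
                  ⊎ IsEdge Cross i v

        union : Structure μ 0ℓ
        union = record { Carrier = Point ; rel = λ i v → truth (Holds i v) }

        -- Positive arity keeps the two images apart, since an empty tuple would lie in both.
        apart : ∀ i {v w} → _≡_ {A = Vec Point (μ i)} (map inj₁ v) (map inj₂ w) → ⊥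
        apart i {v} {w} = go {{positive i}} v w
          where
          go : ∀ {n} → {{NonZero n}} → (v : Vec (Fin (size σ)) n) (w : Vec (Fin (size τ)) n) →
               map inj₁ v ≢ map inj₂ w
          go (x ∷ v) (y ∷ w) ()

        injection₁ : Embedding μ ⟦ σ ⟧ union
        injection₁ = record
          { to = inj₁ ; injective = inj₁-injective
          ; preserves = λ i v → iff⇒≡ (λ holds → truth⁺ (inj₁ (v , refl , holds))) λ holds → back i v (truth⁻ holds) }
          where
          back : ∀ i v → Holds i (map inj₁ v) → rel σ i v ≡ true
          back i v (inj₁ (w , eq , holds)) =
            subst (λ w → rel σ i w ≡ true) (sym (map-injective inj₁-injective eq)) holds
          back i v (inj₂ (inj₁ (w , eq , _))) = contradiction eq (apart i)
          back i v (inj₂ (inj₂ cross)) with isEdge-map⁻ inj₁-injective Cross i v cross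
          ... | _ , _ , _ , () , _

        injection₂ : Embedding μ ⟦ τ ⟧ union
        injection₂ = record
          { to = inj₂ ; injective = inj₂-injective
          ; preserves = λ i v → iff⇒≡ (λ holds → truth⁺ (inj₂ (inj₁ (v , refl , holds)))) λ holds → back i v (truth⁻ holds) }
          where
          back : ∀ i v → Holds i (map inj₂ v) → rel τ i v ≡ true
          back i v (inj₁ (w , eq , _))            = contradiction (sym eq) (apart i)
          back i v (inj₂ (inj₁ (w , eq , holds))) =
            subst (λ w → rel τ i w ≡ true) (sym (map-injective inj₂-injective eq)) holds
          back i v (inj₂ (inj₂ cross)) with isEdge-map⁻ inj₂-injective Cross i v cross
          ... | _ , _ , _ , () , _

        cross⁺ : ∀ {n x y} → Cross n x y → edge union n x y ≡ true
        cross⁺ cross = truth⁺ (inj₂ (inj₂ (_ , _ , _ , cross , refl)))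

        cross⁻₁₂ : ∀ {n x y} → edge union n (inj₁ x) (inj₂ y) ≡ true → n ≡ N + toℕ y
        cross⁻₁₂ {n} holds with truth⁻ holds
        ... | inj₂ (inj₂ cross) = isEdge⁻ Cross cross
        ... | inj₁ (w , eq , _) with unpair inj₁-injective (ix-binary n) w (sym eq)
        ...   | _ , _ , _ , _ , ()
        cross⁻₁₂ {n} holds | inj₂ (inj₁ (w , eq , _)) with unpair inj₂-injective (ix-binary n) w (sym eq)
        ...   | _ , _ , _ , () , _

        cross⁻₂₁ : ∀ {n x y} → edge union n (inj₂ x) (inj₁ y) ≡ true → n ≡ N + toℕ y
        cross⁻₂₁ {n} holds with truth⁻ holds
        ... | inj₂ (inj₂ cross) = isEdge⁻ Cross cross
        ... | inj₁ (w , eq , _) with unpair inj₁-injective (ix-binary n) w (sym eq)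
        ...   | _ , _ , _ , () , _
        cross⁻₂₁ {n} holds | inj₂ (inj₁ (w , eq , _)) with unpair inj₂-injective (ix-binary n) w (sym eq)
        ...   | _ , _ , _ , _ , ()

        edge₁ : ∀ n x y → edge ⟦ σ ⟧ n x y ≡ edge union n (inj₁ x) (inj₁ y)
        edge₁ = edge-preserved injection₁

        edge₂ : ∀ n x y → edge ⟦ τ ⟧ n x y ≡ edge union n (inj₂ x) (inj₂ y)
        edge₂ = edge-preserved injection₂

        union-coloured : Coloured union
        union-coloured = record { colour = colour _ _ ; proper = proper _ _ _ }
          where
          colour : ∀ x y → x ≢ y → ∃[ n ] (edge union n x y ≡ true × (∀ m → edge union m x y ≡ true → m ≡ n))
          colour (inj₁ x) (inj₁ y) x≢y =
            let n , holds , only = σ.colour {x} {y} (x≢y ∘ cong inj₁)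
            in n , trans (sym (edge₁ n x y)) holds , λ m h → only m (trans (edge₁ m x y) h)
          colour (inj₂ x) (inj₂ y) x≢y =
            let n , holds , only = τ.colour {x} {y} (x≢y ∘ cong inj₂)
            in n , trans (sym (edge₂ n x y)) holds , λ m h → only m (trans (edge₂ m x y) h)
          colour (inj₁ x) (inj₂ y) _ = N + toℕ y , cross⁺ {x = inj₁ x} {y = inj₂ y} refl , λ m → cross⁻₁₂
          colour (inj₂ x) (inj₁ y) _ = N + toℕ y , cross⁺ {x = inj₂ x} {y = inj₁ y} refl , λ m → cross⁻₂₁

          ¬below : ∀ {n k} → n < N → n ≢ N + k
          ¬below n<N refl = ℕ.m+n≮m N _ n<N

          proper : ∀ x y z {n} → y ≢ x → z ≢ x → edge union n x y ≡ true → edge union n x z ≡ true → y ≡ z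
          proper (inj₁ x) (inj₁ y) (inj₁ z) {n} y≢x z≢x exy exz = cong inj₁
            (σ.proper (y≢x ∘ cong inj₁) (z≢x ∘ cong inj₁) (trans (edge₁ n x y) exy) (trans (edge₁ n x z) exz))
          proper (inj₁ x) (inj₁ y) (inj₂ z) {n} y≢x z≢x exy exz = contradiction (cross⁻₁₂ exz)
            (¬below (σ-below n (y≢x ∘ cong inj₁ ∘ sym) (trans (edge₁ n x y) exy)))
          proper (inj₁ x) (inj₂ y) (inj₁ z) {n} y≢x z≢x exy exz = contradiction (cross⁻₁₂ exy)
            (¬below (σ-below n (z≢x ∘ cong inj₁ ∘ sym) (trans (edge₁ n x z) exz)))
          proper (inj₁ x) (inj₂ y) (inj₂ z) {n} y≢x z≢x exy exz = cong inj₂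
            (Fin.toℕ-injective (ℕ.+-cancelˡ-≡ N _ _ (trans (sym (cross⁻₁₂ exy)) (cross⁻₁₂ exz))))
          proper (inj₂ x) (inj₂ y) (inj₂ z) {n} y≢x z≢x exy exz = cong inj₂
            (τ.proper (y≢x ∘ cong inj₂) (z≢x ∘ cong inj₂) (trans (edge₂ n x y) exy) (trans (edge₂ n x z) exz))
          proper (inj₂ x) (inj₂ y) (inj₁ z) {n} y≢x z≢x exy exz = contradiction (cross⁻₂₁ exz)
            (¬below (τ-below n (y≢x ∘ cong inj₂ ∘ sym) (trans (edge₂ n x y) exy)))
          proper (inj₂ x) (inj₁ y) (inj₂ z) {n} y≢x z≢x exy exz = contradiction (cross⁻₂₁ exy)
            (¬below (τ-below n (z≢x ∘ cong inj₂ ∘ sym) (trans (edge₂ n x z) exz)))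
          proper (inj₂ x) (inj₁ y) (inj₁ z) {n} y≢x z≢x exy exz = cong inj₁
            (Fin.toℕ-injective (ℕ.+-cancelˡ-≡ N _ _ (trans (sym (cross⁻₂₁ exy)) (cross⁻₂₁ exz))))

        split : Fin (size σ + size τ) → Point
        split = splitAt (size σ)

        split-injective : Injective _≡_ _≡_ split
        split-injective {x} {y} eq = trans (sym (Fin.join-splitAt (size σ) (size τ) x))
          (trans (cong (Fin.join (size σ) (size τ)) eq) (Fin.join-splitAt (size σ) (size τ) y))

        amalgam : FinStructure μ
        amalgam = record { size = size σ + size τ ; rel = λ i v → Structure.rel union i (map split v) }

        amalgam-coloured : Coloured ⟦ amalgam ⟧
        amalgam-coloured = coloured-hereditary
          record { to = split ; injective = split-injective ; preserves = λ _ _ → refl } union-coloured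

        into-amalgam : {𝔄 : Structure μ a} (e : Embedding μ 𝔄 union) (f : Structure.Carrier 𝔄 → Fin (size amalgam)) →
                       (∀ x → split (f x) ≡ Embedding.to e x) → Embedding μ 𝔄 ⟦ amalgam ⟧
        into-amalgam e f section = record
          { to        = f
          ; injective = λ {x} {y} eq → injective (trans (sym (section x)) (trans (cong split eq) (section y)))
          ; preserves = λ i v → trans (preserves i v) (cong (Structure.rel union i)
              (trans (Vec.map-cong (sym ∘ section) v) (Vec.map-∘ split f v)))
          }
          where open Embedding e

        σ≤amalgam : Embedding μ ⟦ σ ⟧ ⟦ amalgam ⟧
        σ≤amalgam = into-amalgam injection₁ (_↑ˡ size τ) (λ x → Fin.splitAt-↑ˡ (size σ) x (size τ))

        τ≤amalgam : Embedding μ ⟦ τ ⟧ ⟦ amalgam ⟧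
        τ≤amalgam = into-amalgam injection₂ (size σ ↑ʳ_) (Fin.splitAt-↑ʳ (size σ) (size τ))

      colouredIdeal : 𝒥 (Ω μ)
      colouredIdeal = record
          { to   = λ σ → truth (Coloured ⟦ σ ⟧)
          ; cong = λ σ≅τ → truth-cong (coloured-hereditary (proj₁ (≅-sym σ≅τ))) (coloured-hereditary (proj₁ σ≅τ))
          } , record
          { nonEmpty   = emptyStructure positive , truth⁺ record { colour = λ { {()} } ; proper = λ { {_} {()} } }
          ; downClosed = λ p q p≤q q∈ → truth⁺ (coloured-hereditary p≤q (truth⁻ q∈))
          ; upDirected = λ p q p∈ q∈ →
              let open Amalgam p q (truth⁻ p∈) (truth⁻ q∈)
              in amalgam , truth⁺ amalgam-coloured , σ≤amalgam , τ≤amalgam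
          }

      -- Each condition concerns at most three points, so it can be tested in the substructure that
      -- they span.
      locally-coloured : (𝔄 : Structure μ a) → (∀ σ → Embedding μ ⟦ σ ⟧ 𝔄 → Coloured ⟦ σ ⟧) → Coloured 𝔄
      locally-coloured 𝔄 local = record
        { colour = λ {x} {y} x≢y →
            let e = lookup-embedding 𝔄 {x ∷ y ∷ []} ((x≢y ∷ []) ∷ [] ∷ [])
                n , holds , only = Coloured.colour (local _ e) {0F} {1F} λ ()
            in n , trans (sym (edge-preserved e n 0F 1F)) holds
                 , λ m holds′ → only m (trans (edge-preserved e m 0F 1F) holds′)
        ; proper = λ {n} {x} {y} {z} y≢x z≢x exy exz → stable λ y≢z →
            let e = lookup-embedding 𝔄 {x ∷ y ∷ z ∷ []}
                      ((y≢x ∘ sym ∷ z≢x ∘ sym ∷ []) ∷ (y≢z ∷ []) ∷ [] ∷ [])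
            in case Coloured.proper (local _ e) {n} {0F} {1F} {2F} (λ ()) (λ ())
                 (trans (edge-preserved e n 0F 1F) exy) (trans (edge-preserved e n 0F 2F) exz) of λ ()
        }

      module _ (α : ℕ → Bool) where

        markedP : ℕ → Fin 1 → Fin 1 → Set
        markedP n _ _ = α n ≡ true

        -- The loops of the single point spell out `α`. As `Coloured` ignores loops, all these
        -- structures belong to the ideal.
        marked : FinStructure μ
        marked = spanned 1 markedP

        marked-coloured : Coloured ⟦ marked ⟧
        marked-coloured = record
          { colour = λ x≢y → contradiction (fin1-unique _ _) x≢y
          ; proper = λ y≢x → contradiction (fin1-unique _ _) y≢x
          }

        marked-edge : ∀ n → edge ⟦ marked ⟧ n 0F 0F ≡ α n
        marked-edge n = iff⇒≡ (spanned-edge⁻ markedP {n} {0F} {0F}) (spanned-edge⁺ markedP {n} {0F} {0F})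

      -- A representing structure contains a point for every `α`, distinct because their loops
      -- differ. It is itself properly coloured, so the colours of the edges leaving one of these
      -- points would number all the others injectively.
      not-representable : ¬ Representable μ colouredIdeal
      not-representable (𝔄 , age) = cantor Code total injective
        where
        open Structure 𝔄 using (Carrier)

        embeds⇒coloured : ∀ σ → Embedding μ ⟦ σ ⟧ 𝔄 → Coloured ⟦ σ ⟧
        embeds⇒coloured σ e = truth⁻ (Equivalence.to (age σ) (Equivalence.from (age⇔embeds 𝔄 σ) e))

        coloured⇒embeds : ∀ σ → Coloured ⟦ σ ⟧ → Embedding μ ⟦ σ ⟧ 𝔄
        coloured⇒embeds σ col = Equivalence.to (age⇔embeds 𝔄 σ) (Equivalence.from (age σ) (truth⁺ col))

        open Coloured (locally-coloured 𝔄 embeds⇒coloured)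

        e : ∀ α → Embedding μ ⟦ marked α ⟧ 𝔄
        e α = coloured⇒embeds (marked α) (marked-coloured α)

        point : (ℕ → Bool) → Carrier
        point α = Embedding.to (e α) 0F

        point-injective : ∀ {α β} → point α ≡ point β → α ≡ β
        point-injective {α} {β} eq = ext λ n →
          trans (loops α n) (trans (cong (λ x → edge 𝔄 n x x) eq) (sym (loops β n)))
          where
          loops : ∀ α n → α n ≡ edge 𝔄 n (point α) (point α)
          loops α n = trans (sym (marked-edge α n)) (edge-preserved (e α) n 0F 0F)

        centre : Carrier
        centre = point (const false)

        -- Code `0` is kept for the centre, to which no edge colour applies; colours are therefore
        -- shifted by one.
        Code : ℕ → (ℕ → Bool) → Set ℓ
        Code zero    α = point α ≡ centre
        Code (suc n) α = point α ≢ centre × edge 𝔄 n centre (point α) ≡ true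

        total : ∀ α → ∃[ k ] Code k α
        total α with em {P = point α ≡ centre}
        ... | yes eq = 0 , eq
        ... | no neq = let n , holds , _ = colour (neq ∘ sym) in suc n , neq , holds

        injective : ∀ {k α β} → Code k α → Code k β → α ≡ β
        injective {zero}  eq eq′ = point-injective (trans eq (sym eq′))
        injective {suc n} (neq , exα) (neq′ , exβ) = point-injective (proper neq neq′ exα exβ)

theorem1 : (∀ {a} → ExcludedMiddle a) → (∀ {a b} → Extensionality a b) →
    ∀ {ℓ} (I : Set ℓ) (μ : I → ℕ) → (∀ i → NonZero (μ i)) →
    ((∀ (S : 𝒥 (Ω μ)) → Representable μ S) ⇔ Finite (∃[ i ] 2 ≤ μ i))
    × (Finite (∃[ i ] 2 ≤ μ i) ⇔ Compact (𝒥-topology (Ω μ)))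
theorem1 em ext I μ positive =
    mk⇔
      (λ representable → stable em ext λ infinite →
        let label , injective = sequence em ext infinite
        in not-representable em ext positive label injective
             (representable (colouredIdeal em ext positive label injective)))
      (λ finite → ideal-representable em ext positive (enumerate finite))
  , mk⇔ {B = Compact (𝒥-topology (Ω μ))}
      (λ finite → ideals-compact em ext positive (enumerate finite))
      (λ compact → stable em ext λ infinite →
        let label , injective = sequence em ext infinite
        in not-compact em ext positive label injective compact)
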